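{- Let $d \geq 1$ and let $A \subset \mathbb{Z}^d$ be a set consisting of exactly $d+2$ elements such that the difference set $A - A = \{a - a' : a, a' \in A\}$ generates $\mathbb{Z}^d$ additively. Let $\Delta_A$ denote the convex hull of $A$ and $\mathrm{vol}(\Delta_A)$ its $d$-dimensional volume. Then \[ |hA| = \binom{h+d+1}{d+1} \qquad \text{whenever } 0 \leq h < \mathrm{vol}(\Delta_A)\cdot d! - d - 1, \] and \[ |hA| = \binom{h+d+1}{d+1} - \binom{h - \mathrm{vol}(\Delta_A)\cdot d! + d + 1}{d+1} \qquad \text{whenever } h \geq \mathrm{vol}(\Delta_A)\cdot d! - d - 1 . \]
   Context: For a finite set $A \subset \mathbb{Z}^d$ and an integer $h \geq 0$, the $h$-fold sumset is $hA = \{x_1 + \cdots + x_h : x_i \in A\}$ (with $0A = \{0\}$); $h$ ranges over integers. -}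

module Defs where

open import Data.Nat.Base using (ℕ; zero; suc)
open import Data.Integer.Base as ℤ using (ℤ; 0ℤ)
import Data.Integer.Properties as ℤ
open import Data.Rational.Base as ℚ using (ℚ; 0ℚ; 1ℚ)
open import Data.List.Base as List using (List; cartesianProductWith; deduplicate; length)
open import Data.List.Relation.Unary.Any using (Any)
open import Data.List.Relation.Unary.AllPairs using (AllPairs)
open import Data.Product.Base using (∃-syntax; _×_)
open import Data.Vec.Base using (Vec; zipWith; replicate; map; foldr′; toList)
open import Data.Vec.Membership.Propositional using () renaming (_∈_ to _∈ᵛ_)
open import Data.Vec.Properties using (≡-dec)
open import Data.Vec.Relation.Unary.All using (All)
open import Data.Vec.Relation.Binary.Pointwise.Inductive using (Pointwise)
open import Level using (0ℓ)
open import Relation.Binary.Definitions using (DecidableEquality)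
open import Relation.Binary.PropositionalEquality.Core using (_≡_)
open import Relation.Unary using (Pred; _∈_; _⊆_; _⊥_; Universal)

ℤ^_ : ℕ → Set
ℤ^ d = Vec ℤ d

ℚ^_ : ℕ → Set
ℚ^ d = Vec ℚ d

module _ {d : ℕ} where

  infixl 6 _+ᶻ_ _-ᶻ_ _+ᵠ_
  infixl 7 _·ᵠ_

  0ᶻ : ℤ^ d
  0ᶻ = replicate d 0ℤ

  _+ᶻ_ _-ᶻ_ : ℤ^ d → ℤ^ d → ℤ^ d
  _+ᶻ_ = zipWith ℤ._+_
  _-ᶻ_ = zipWith ℤ._-_

  -ᶻ_ : ℤ^ d → ℤ^ d
  -ᶻ_ = map (λ i → ℤ.- i)

  _≟ᶻ_ : DecidableEquality (ℤ^ d)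
  _≟ᶻ_ = ≡-dec ℤ._≟_

  0ᵠ : ℚ^ d
  0ᵠ = replicate d 0ℚ

  _+ᵠ_ : ℚ^ d → ℚ^ d → ℚ^ d
  _+ᵠ_ = zipWith ℚ._+_

  _·ᵠ_ : ℚ → ℚ^ d → ℚ^ d
  q ·ᵠ x = map (q ℚ.*_) x

fromℤ : ℤ → ℚ
fromℤ i = i ℚ./ 1

-- Finite sets of lattice points are given by vectors without repetitions.

-- The list enumerates hA, possibly with repetitions.
sumset : ∀ {d n} → ℕ → Vec (ℤ^ d) n → List (ℤ^ d)
sumset zero    A = List.[ 0ᶻ ]
sumset (suc h) A = cartesianProductWith _+ᶻ_ (toList A) (sumset h A)

card : ∀ {d} → List (ℤ^ d) → ℕ
card xs = length (deduplicate _≟ᶻ_ xs)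

differenceSet : ∀ {d n} → Vec (ℤ^ d) n → Pred (ℤ^ d) 0ℓ
differenceSet A x = ∃[ a ] ∃[ a′ ] a ∈ᵛ A × a′ ∈ᵛ A × x ≡ a -ᶻ a′

data ⟨_⟩ {d : ℕ} (S : Pred (ℤ^ d) 0ℓ) : Pred (ℤ^ d) 0ℓ where
  gen  : ∀ {x} → x ∈ S → x ∈ ⟨ S ⟩
  zero : 0ᶻ ∈ ⟨ S ⟩
  add  : ∀ {x y} → x ∈ ⟨ S ⟩ → y ∈ ⟨ S ⟩ → (x +ᶻ y) ∈ ⟨ S ⟩
  neg  : ∀ {x} → x ∈ ⟨ S ⟩ → (-ᶻ x) ∈ ⟨ S ⟩

Generates : ∀ {d} → Pred (ℤ^ d) 0ℓ → Set
Generates S = Universal ⟨ S ⟩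

-- The rational points of the convex hull of A.  As A consists of lattice
-- points, the real convex hull is the closure of this set and contains no
-- further rational points.
Δ : ∀ {d n} → Vec (ℤ^ d) n → Pred (ℚ^ d) 0ℓ
Δ {n = n} A x =
  ∃[ w ] All (0ℚ ℚ.≤_) {n} w
       × foldr′ ℚ._+_ 0ℚ w ≡ 1ℚ
       × x ≡ foldr′ _+ᵠ_ 0ᵠ (zipWith _·ᵠ_ w (map (map fromℤ) A))

record Interval : Set where
  constructor [_,_⟩
  field
    lo hi : ℚ
    lo≤hi : lo ℚ.≤ hi

open Interval public

Box : ℕ → Set
Box d = Vec Interval d

⟦_⟧ : ∀ {d} → Box d → Pred (ℚ^ d) 0ℓ
⟦ B ⟧ x = Pointwise (λ q I → lo I ℚ.≤ q × q ℚ.< hi I) x B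

⋃ : ∀ {d} → List (Box d) → Pred (ℚ^ d) 0ℓ
⋃ Bs x = Any (λ B → x ∈ ⟦ B ⟧) Bs

boxVolume : ∀ {d} → Box d → ℚ
boxVolume B = foldr′ ℚ._*_ 1ℚ (map (λ I → hi I ℚ.- lo I) B)

totalVolume : ∀ {d} → List (Box d) → ℚ
totalVolume Bs = List.foldr ℚ._+_ 0ℚ (List.map boxVolume Bs)

-- S has d-dimensional volume v in the sense of Jordan content: finite
-- disjoint unions of boxes inside S, and finite covers of S by boxes, have
-- total volume arbitrarily close to v.  Rational endpoints lose nothing, and
-- for the rational points of a rational polytope this is its Lebesgue measure.
HasVolume : ∀ {d} → Pred (ℚ^ d) 0ℓ → ℚ → Set
HasVolume S v = ∀ ε → 0ℚ ℚ.< ε →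
    (∃[ Bs ] AllPairs (λ B B′ → ⟦ B ⟧ ⊥ ⟦ B′ ⟧) Bs × ⋃ Bs ⊆ S × v ℚ.- ε ℚ.< totalVolume Bs)
  × (∃[ Bs ] S ⊆ ⋃ Bs × totalVolume Bs ℚ.< v ℚ.+ ε)

{-# OPTIONS --safe #-}

-- Lift A to A × {1}. Since A - A generates ℤᵈ, the lifted d + 2 points generate
-- ℤᵈ⁺¹, so their relations form a cyclic group ℤ ℓ. Write ℓ = P - Q with P, Q ≥ 0
-- of disjoint supports and let D = Σ P = Σ Q. A point of hA has exactly one
-- representation by coefficients c ∈ ℕᵈ⁺² with Σ c = h and not P ≤ c; counting
-- these gives |hA| = C(h+d+1, d+1) - C(h-D+d+1, d+1), hence |hA| ~ D hᵈ / d!.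
--
-- The volume of the hull is found by counting as well. If N clears the
-- denominators of a finite union of boxes, the union contains exactly Nᵈ vol
-- points of (1/N) ℤᵈ. All points of (1/N) NA lie in the hull; conversely, if x / N
-- lies in the hull, then x plus a fixed vector lies in (N + 2D)A: a representation of
-- x by nonnegative rational coefficients of sum N differs from an integral one by a
-- rational multiple of ℓ, and rounding that multiple changes the coefficients by at
-- most |ℓ|. So vol = D / d!.

module Submission where

open import Defs
open import Algebra.Properties.AbelianGroup using (∙-cancelʳ; ∙-cancelˡ)
open import Algebra.Properties.CommutativeSemigroup using (interchange; x∙yz≈y∙xz)
open import Data.Nat.Base as ℕ using (ℕ; zero; suc; _+_; _*_; _∸_; _^_; _≤_; _<_; _≥_; z≤n; s≤s; NonZero; _!)
open import Data.Nat.Combinatorics using (_C_; nCk+nC[k+1]≡[n+1]C[k+1]; nCn≡1; nC1≡n; k>n⇒nCk≡0)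
import Data.Nat.Induction as ℕ
import Data.Nat.Properties as ℕ
import Data.Nat.Tactic.RingSolver as ℕ-Solver
open import Data.Integer.Base as ℤ using (ℤ; +_; 0ℤ; 1ℤ; -1ℤ; -[1+_])
import Data.Integer.DivMod as ℤ
import Data.Integer.Properties as ℤ
open import Data.Integer.Tactic.RingSolver using (solve-∀)
open import Data.Rational.Base as ℚ using (ℚ; 0ℚ; 1ℚ; toℚᵘ)
import Data.Rational.Properties as ℚ
open import Data.Rational.Solver using (module +-*-Solver)
open import Data.Rational.Unnormalised.Base as ℚᵘ using (mkℚᵘ; *≡*; *≤*; *<*; _≃_)
import Data.Rational.Unnormalised.Properties as ℚᵘ
open import Data.Empty using (⊥-elim)
open import Data.List.Base as List using (List; length; filter; cartesianProductWith; upTo)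
import Data.List.Properties as List
open import Data.List.Membership.Propositional using (_∈_)
open import Data.List.Membership.Propositional.Properties
open import Data.List.Relation.Unary.All as All using ([]; _∷_)
open import Data.List.Relation.Unary.AllPairs using (AllPairs; []; _∷_)
open import Data.List.Relation.Unary.Any using (here; there)
open import Data.List.Relation.Unary.Unique.Propositional using () renaming (Unique to Uniqueₗ)
import Data.List.Relation.Unary.Unique.DecPropositional.Properties as UniqueDec
import Data.List.Relation.Unary.Unique.Propositional.Properties as Unique
open import Data.Product.Base using (_×_; _,_; proj₁; proj₂; ∃; ∃-syntax)
open import Data.Sum.Base using (inj₁; inj₂)
open import Data.Vec.Base using (Vec; []; _∷_; map; head; tail; replicate; zipWith; sum; toList; foldr′)
open import Data.Vec.Properties using (∷-injective; ∷-injectiveˡ; ∷-injectiveʳ)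
open import Data.Vec.Membership.Propositional using () renaming (_∈_ to _∈ᵛ_)
open import Data.Vec.Membership.Propositional.Properties using (∈-toList⁻)
open import Data.Vec.Relation.Binary.Pointwise.Inductive as Pointwise using (Pointwise; []; _∷_)
open import Data.Vec.Relation.Unary.All as VecAll using ([]; _∷_)
import Data.Vec.Relation.Unary.All.Properties as VecAll
open import Data.Vec.Relation.Unary.Any using (here; there)
open import Data.Vec.Relation.Unary.Unique.Propositional using (Unique)
open import Function.Base using (_∘_)
open import Induction.WellFounded using (Acc; acc)
open import Level using (0ℓ)
open import Relation.Nullary using (¬_; yes; no; ¬?; contradiction)
open import Relation.Unary using (Pred; Decidable; _⊆_; _⊥_)
open import Relation.Binary.PropositionalEquality

-- Counting replaces every explicit volume formula: no triangulation of the hull and no determinant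
-- occurs, and the volume enters only through inner and outer box approximations. Their grid counts
-- at scale `k M` are exactly `kᵈ` times those at scale `M`, so each approximation yields one
-- inequality between `l kᵈ` and a sumset cardinality for all `k`. Comparing leading coefficients
-- therefore needs no real limit: an inequality `a mᵈ ≤ b (m + 1)ᵈ` for all `m` forces `a ≤ b`, and
-- every bounded shift is absorbed into the passage from `m` to `m + 1`.
--
-- That the lifted points generate `ℤᵈ⁺¹` matters twice. It makes the group of relations cyclic, and
-- it supplies for each `(N , x)` an integral representation, possibly with negative coefficients,
-- from which the rounding starts.
--
-- The count changes form at `h = D`, whereas the theorem changes form at `D - d - 1`. In between,
-- the subtracted binomial coefficient vanishes, so both formulas hold there.

private variable
  d n : ℕ
  X Y Z : Set

-- Kernels of surjections ℤᵐ⁺¹ → ℤᵐ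

infixl 7 _·ᶻ_

_·ᶻ_ : ∀ {d} → ℤ → ℤ^ d → ℤ^ d
k ·ᶻ x = map (k ℤ.*_) x

·ᶻ-zeroʳ : ∀ d k → k ·ᶻ 0ᶻ {d} ≡ 0ᶻ
·ᶻ-zeroʳ zero    k = refl
·ᶻ-zeroʳ (suc d) k = cong₂ _∷_ (ℤ.*-zeroʳ k) (·ᶻ-zeroʳ d k)

·ᶻ-zeroˡ : ∀ {d} (x : ℤ^ d) → 0ℤ ·ᶻ x ≡ 0ᶻ
·ᶻ-zeroˡ []      = refl
·ᶻ-zeroˡ (_ ∷ x) = cong (0ℤ ∷_) (·ᶻ-zeroˡ x)

+ᶻ-identityˡ : ∀ {d} (x : ℤ^ d) → 0ᶻ +ᶻ x ≡ x
+ᶻ-identityˡ []      = refl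
+ᶻ-identityˡ (a ∷ x) = cong₂ _∷_ (ℤ.+-identityˡ a) (+ᶻ-identityˡ x)

record Linear {m n} (f : ℤ^ m → ℤ^ n) : Set where
  field
    +-homo : ∀ x y → f (x +ᶻ y) ≡ f x +ᶻ f y
    ·-homo : ∀ k x → f (k ·ᶻ x) ≡ k ·ᶻ f x

  0-homo : f 0ᶻ ≡ 0ᶻ
  0-homo = begin
    f 0ᶻ           ≡⟨ cong f (·ᶻ-zeroˡ 0ᶻ) ⟨
    f (0ℤ ·ᶻ 0ᶻ)   ≡⟨ ·-homo 0ℤ 0ᶻ ⟩
    0ℤ ·ᶻ f 0ᶻ     ≡⟨ ·ᶻ-zeroˡ (f 0ᶻ) ⟩
    0ᶻ             ∎
    where open ≡-Reasoning

open Linear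

∘-linear : ∀ {l m n} {f : ℤ^ m → ℤ^ n} {g : ℤ^ l → ℤ^ m} → Linear f → Linear g → Linear (f ∘ g)
∘-linear {f = f} F G .+-homo x y = trans (cong f (+-homo G x y)) (+-homo F _ _)
∘-linear {f = f} F G .·-homo k x = trans (cong f (·-homo G k x)) (·-homo F k _)

0∷-linear : ∀ {n} → Linear {n} (0ℤ ∷_)
0∷-linear .+-homo x y = refl
0∷-linear .·-homo k x = cong (_∷ k ·ᶻ x) (sym (ℤ.*-zeroʳ k))

tail-linear : ∀ {n} → Linear {suc n} tail
tail-linear .+-homo (_ ∷ _) (_ ∷ _) = refl
tail-linear .·-homo k (_ ∷ _)       = refl

record Automorphism (n : ℕ) : Set where
  field
    to from   : ℤ^ n → ℤ^ n
    to-linear : Linear to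
    to∘from   : ∀ x → to (from x) ≡ x
    from∘to   : ∀ x → from (to x) ≡ x

open Automorphism

identity : ∀ {n} → Automorphism n
identity .to x      = x
identity .from x    = x
identity .to-linear = record { +-homo = λ _ _ → refl ; ·-homo = λ _ _ → refl }
identity .to∘from x = refl
identity .from∘to x = refl

_∘ₐ_ : ∀ {n} → Automorphism n → Automorphism n → Automorphism n
(U ∘ₐ V) .to        = to U ∘ to V
(U ∘ₐ V) .from      = from V ∘ from U
(U ∘ₐ V) .to-linear = ∘-linear (to-linear U) (to-linear V)
(U ∘ₐ V) .to∘from x = trans (cong (to U) (to∘from V _)) (to∘from U x)
(U ∘ₐ V) .from∘to x = trans (cong (from V) (from∘to U _)) (from∘to V x)

lift : ∀ {n} → Automorphism n → Automorphism (suc n)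
lift U .to (a ∷ x)   = a ∷ to U x
lift U .from (a ∷ x) = a ∷ from U x
lift U .to-linear .+-homo (_ ∷ x) (_ ∷ y) = cong (_ ∷_) (+-homo (to-linear U) x y)
lift U .to-linear .·-homo k (_ ∷ x)       = cong (_ ∷_) (·-homo (to-linear U) k x)
lift U .to∘from (_ ∷ x) = cong (_ ∷_) (to∘from U x)
lift U .from∘to (_ ∷ x) = cong (_ ∷_) (from∘to U x)

record Unimodular : Set where
  field
    m₁₁ m₁₂ m₂₁ m₂₂ : ℤ
    det≡1           : m₁₁ ℤ.* m₂₂ ℤ.- m₁₂ ℤ.* m₂₁ ≡ 1ℤ

open Unimodular

private
  cancel-det : ∀ {Δ : ℤ} x {y} → Δ ≡ 1ℤ → y ≡ Δ ℤ.* x → y ≡ x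
  cancel-det x refl e = trans e (ℤ.*-identityˡ x)

  add₁ : ∀ p q a b c d → p ℤ.* (a ℤ.+ b) ℤ.+ q ℤ.* (c ℤ.+ d) ≡ (p ℤ.* a ℤ.+ q ℤ.* c) ℤ.+ (p ℤ.* b ℤ.+ q ℤ.* d)
  add₁ = solve-∀

  mul₁ : ∀ p q k a c → p ℤ.* (k ℤ.* a) ℤ.+ q ℤ.* (k ℤ.* c) ≡ k ℤ.* (p ℤ.* a ℤ.+ q ℤ.* c)
  mul₁ = solve-∀

  inv₁ : ∀ p q r s a b → p ℤ.* (s ℤ.* a ℤ.- q ℤ.* b) ℤ.+ q ℤ.* (p ℤ.* b ℤ.- r ℤ.* a) ≡ (p ℤ.* s ℤ.- q ℤ.* r) ℤ.* a
  inv₁ = solve-∀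

  inv₂ : ∀ p q r s a b → r ℤ.* (s ℤ.* a ℤ.- q ℤ.* b) ℤ.+ s ℤ.* (p ℤ.* b ℤ.- r ℤ.* a) ≡ (p ℤ.* s ℤ.- q ℤ.* r) ℤ.* b
  inv₂ = solve-∀

  inv₃ : ∀ p q r s a b → s ℤ.* (p ℤ.* a ℤ.+ q ℤ.* b) ℤ.- q ℤ.* (r ℤ.* a ℤ.+ s ℤ.* b) ≡ (p ℤ.* s ℤ.- q ℤ.* r) ℤ.* a
  inv₃ = solve-∀

  inv₄ : ∀ p q r s a b → p ℤ.* (r ℤ.* a ℤ.+ s ℤ.* b) ℤ.- r ℤ.* (p ℤ.* a ℤ.+ q ℤ.* b) ≡ (p ℤ.* s ℤ.- q ℤ.* r) ℤ.* b
  inv₄ = solve-∀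

-- The inverse is the adjugate matrix, which is integral and needs no division because the
-- determinant is 1.
onPlane : ∀ {n} → Unimodular → Automorphism (suc (suc n))
onPlane M .to (a ∷ b ∷ x)   = m₁₁ M ℤ.* a ℤ.+ m₁₂ M ℤ.* b ∷ m₂₁ M ℤ.* a ℤ.+ m₂₂ M ℤ.* b ∷ x
onPlane M .from (a ∷ b ∷ x) = m₂₂ M ℤ.* a ℤ.- m₁₂ M ℤ.* b ∷ m₁₁ M ℤ.* b ℤ.- m₂₁ M ℤ.* a ∷ x
onPlane M .to-linear .+-homo (a ∷ c ∷ _) (b ∷ d ∷ _) =
  cong₂ (λ x y → x ∷ y ∷ _) (add₁ (m₁₁ M) (m₁₂ M) a b c d) (add₁ (m₂₁ M) (m₂₂ M) a b c d)
onPlane M .to-linear .·-homo k (a ∷ b ∷ _) =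
  cong₂ (λ x y → x ∷ y ∷ _) (mul₁ (m₁₁ M) (m₁₂ M) k a b) (mul₁ (m₂₁ M) (m₂₂ M) k a b)
onPlane M .to∘from (a ∷ b ∷ _) = cong₂ (λ x y → x ∷ y ∷ _)
  (cancel-det a (det≡1 M) (inv₁ (m₁₁ M) (m₁₂ M) (m₂₁ M) (m₂₂ M) a b))
  (cancel-det b (det≡1 M) (inv₂ (m₁₁ M) (m₁₂ M) (m₂₁ M) (m₂₂ M) a b))
onPlane M .from∘to (a ∷ b ∷ _) = cong₂ (λ x y → x ∷ y ∷ _)
  (cancel-det a (det≡1 M) (inv₃ (m₁₁ M) (m₁₂ M) (m₂₁ M) (m₂₂ M) a b))
  (cancel-det b (det≡1 M) (inv₄ (m₁₁ M) (m₁₂ M) (m₂₁ M) (m₂₂ M) a b))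

-- The Euclidean algorithm as column operations on the row `(a , b)`. What matters later is the
-- vanishing second entry.
euclid : ∀ a b → ∃[ M ] ∃[ g ] a ℤ.* m₁₁ M ℤ.+ b ℤ.* m₂₁ M ≡ g × a ℤ.* m₁₂ M ℤ.+ b ℤ.* m₂₂ M ≡ 0ℤ
euclid a b = go a b (ℕ.<-wellFounded ℤ.∣ b ∣)
  where
  step₁ : ∀ b k c p r → (c ℤ.+ k ℤ.* b) ℤ.* r ℤ.+ b ℤ.* (p ℤ.- k ℤ.* r) ≡ b ℤ.* p ℤ.+ c ℤ.* r
  step₁ = solve-∀

  step₂ : ∀ b k c q s → (c ℤ.+ k ℤ.* b) ℤ.* ℤ.- s ℤ.+ b ℤ.* (k ℤ.* s ℤ.- q) ≡ ℤ.- (b ℤ.* q ℤ.+ c ℤ.* s)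
  step₂ = solve-∀

  det : ∀ p q r s k → r ℤ.* (k ℤ.* s ℤ.- q) ℤ.- ℤ.- s ℤ.* (p ℤ.- k ℤ.* r) ≡ p ℤ.* s ℤ.- q ℤ.* r
  det = solve-∀

  base₁ : ∀ a → a ℤ.* 1ℤ ℤ.+ 0ℤ ℤ.* 0ℤ ≡ a
  base₁ = solve-∀

  base₂ : ∀ a → a ℤ.* 0ℤ ℤ.+ 0ℤ ℤ.* 1ℤ ≡ 0ℤ
  base₂ = solve-∀

  go : ∀ a b → Acc ℕ._<_ ℤ.∣ b ∣ → ∃[ M ] ∃[ g ] a ℤ.* m₁₁ M ℤ.+ b ℤ.* m₂₁ M ≡ g × a ℤ.* m₁₂ M ℤ.+ b ℤ.* m₂₂ M ≡ 0ℤ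
  go a b (acc rec) with b ℤ.≟ 0ℤ
  ... | yes refl = record { m₁₁ = 1ℤ ; m₁₂ = 0ℤ ; m₂₁ = 0ℤ ; m₂₂ = 1ℤ ; det≡1 = refl } , a , base₁ a , base₂ a
  ... | no b≢0 = M′ , g
    , trans (cong (λ z → z ℤ.* m₂₁ M ℤ.+ b ℤ.* (m₁₁ M ℤ.- k ℤ.* m₂₁ M)) a≡) (trans (step₁ b k c (m₁₁ M) (m₂₁ M)) e₁)
    , trans (cong (λ z → z ℤ.* ℤ.- m₂₂ M ℤ.+ b ℤ.* (k ℤ.* m₂₂ M ℤ.- m₁₂ M)) a≡)
        (trans (step₂ b k c (m₁₂ M) (m₂₂ M)) (cong ℤ.-_ e₂))
    where
    instance
      b-nonZero : ℤ.NonZero b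
      b-nonZero = ℤ.≢-nonZero b≢0

    k c : ℤ
    k = a ℤ./ b
    c = + (a ℤ.% b)

    a≡ : a ≡ c ℤ.+ k ℤ.* b
    a≡ = ℤ.a≡a%n+[a/n]*n a b

    ih = go b c (rec (ℤ.n%d<d a b))

    M : Unimodular
    M = proj₁ ih

    g : ℤ
    g = proj₁ (proj₂ ih)

    e₁ = proj₁ (proj₂ (proj₂ ih))
    e₂ = proj₂ (proj₂ (proj₂ ih))

    -- The division step turns `(a , b)` into `(b , c)` by a matrix of determinant -1. Negating the
    -- second column of the product restores determinant 1 and only changes the sign of an entry
    -- that is zero.
    M′ : Unimodular
    M′ .m₁₁   = m₂₁ M
    M′ .m₁₂   = ℤ.- m₂₂ M
    M′ .m₂₁   = m₁₁ M ℤ.- k ℤ.* m₂₁ M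
    M′ .m₂₂   = k ℤ.* m₂₂ M ℤ.- m₁₂ M
    M′ .det≡1 = trans (det (m₁₁ M) (m₁₂ M) (m₂₁ M) (m₂₂ M) k) (det≡1 M)

head-split : ∀ {m n} {f : ℤ^ suc n → ℤ^ suc m} → Linear f → ∀ a x →
             head (f (a ∷ x)) ≡ a ℤ.* head (f (1ℤ ∷ 0ᶻ)) ℤ.+ head (f (0ℤ ∷ x))
head-split {n = n} {f} F a x = begin
  head (f (a ∷ x))                              ≡⟨ cong (head ∘ f) split ⟩
  head (f (a ·ᶻ (1ℤ ∷ 0ᶻ) +ᶻ (0ℤ ∷ x)))         ≡⟨ cong head (+-homo F _ _) ⟩
  head (f (a ·ᶻ (1ℤ ∷ 0ᶻ)) +ᶻ f (0ℤ ∷ x))       ≡⟨ cong (λ v → head (v +ᶻ f (0ℤ ∷ x))) (·-homo F a _) ⟩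
  head (a ·ᶻ f (1ℤ ∷ 0ᶻ) +ᶻ f (0ℤ ∷ x))         ≡⟨ head-lemma (f (1ℤ ∷ 0ᶻ)) (f (0ℤ ∷ x)) ⟩
  a ℤ.* head (f (1ℤ ∷ 0ᶻ)) ℤ.+ head (f (0ℤ ∷ x)) ∎
  where
  open ≡-Reasoning
  split : a ∷ x ≡ a ·ᶻ (1ℤ ∷ 0ᶻ) +ᶻ (0ℤ ∷ x)
  split = cong₂ _∷_ (sym (trans (ℤ.+-identityʳ _) (ℤ.*-identityʳ a)))
                    (sym (trans (cong (_+ᶻ x) (·ᶻ-zeroʳ n a)) (+ᶻ-identityˡ x)))
  head-lemma : ∀ {m} (u v : ℤ^ suc m) → head (a ·ᶻ u +ᶻ v) ≡ a ℤ.* head u ℤ.+ head v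
  head-lemma (_ ∷ _) (_ ∷ _) = refl

-- Hermite reduction of a single row. By induction the coefficients of all coordinates but the first
-- are merged into `g′`; a unimodular change of the first two coordinates then merges `g′` with the
-- coefficient of the first.
diagonalizeHead : ∀ {m n} (f : ℤ^ suc n → ℤ^ suc m) → Linear f →
                  ∃[ U ] ∃[ g ] ∀ x → head (f (to U x)) ≡ g ℤ.* head x
diagonalizeHead {n = zero} f F = identity , head (f (1ℤ ∷ [])) , λ where
    (a ∷ []) → trans (head-split F a []) (lemma a _ _ (cong head (0-homo F)))
  where
  lemma : ∀ a b c → c ≡ 0ℤ → a ℤ.* b ℤ.+ c ≡ b ℤ.* a
  lemma a b c refl = trans (ℤ.+-identityʳ _) (ℤ.*-comm a b)
diagonalizeHead {n = suc n} f F
  with diagonalizeHead (f ∘ (0ℤ ∷_)) (∘-linear F 0∷-linear)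
... | U , g′ , eq with euclid (head (f (1ℤ ∷ 0ᶻ))) g′
...   | M , g , e₁ , e₂ = lift U ∘ₐ onPlane M , g , λ where
    (x ∷ y ∷ z) → begin
      head (f (m₁₁ M ℤ.* x ℤ.+ m₁₂ M ℤ.* y ∷ to U (m₂₁ M ℤ.* x ℤ.+ m₂₂ M ℤ.* y ∷ z)))
        ≡⟨ head-split F _ _ ⟩
      (m₁₁ M ℤ.* x ℤ.+ m₁₂ M ℤ.* y) ℤ.* a ℤ.+ head (f (0ℤ ∷ to U (m₂₁ M ℤ.* x ℤ.+ m₂₂ M ℤ.* y ∷ z)))
        ≡⟨ cong (λ c → (m₁₁ M ℤ.* x ℤ.+ m₁₂ M ℤ.* y) ℤ.* a ℤ.+ c) (eq _) ⟩
      (m₁₁ M ℤ.* x ℤ.+ m₁₂ M ℤ.* y) ℤ.* a ℤ.+ g′ ℤ.* (m₂₁ M ℤ.* x ℤ.+ m₂₂ M ℤ.* y)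
        ≡⟨ regroup (m₁₁ M) (m₁₂ M) (m₂₁ M) (m₂₂ M) x y a g′ ⟩
      (a ℤ.* m₁₁ M ℤ.+ g′ ℤ.* m₂₁ M) ℤ.* x ℤ.+ (a ℤ.* m₁₂ M ℤ.+ g′ ℤ.* m₂₂ M) ℤ.* y
        ≡⟨ cong₂ (λ u v → u ℤ.* x ℤ.+ v ℤ.* y) e₁ e₂ ⟩
      g ℤ.* x ℤ.+ 0ℤ ℤ.* y
        ≡⟨ ℤ.+-identityʳ _ ⟩
      g ℤ.* x ∎
  where
  open ≡-Reasoning
  a = head (f (1ℤ ∷ 0ᶻ))
  regroup : ∀ p q r s x y a g → (p ℤ.* x ℤ.+ q ℤ.* y) ℤ.* a ℤ.+ g ℤ.* (r ℤ.* x ℤ.+ s ℤ.* y)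
            ≡ (a ℤ.* p ℤ.+ g ℤ.* r) ℤ.* x ℤ.+ (a ℤ.* q ℤ.+ g ℤ.* s) ℤ.* y
  regroup = solve-∀

head-tail-≡ : ∀ {n a} {x : ℤ^ suc n} {y : ℤ^ n} → head x ≡ a → tail x ≡ y → x ≡ a ∷ y
head-tail-≡ {x = _ ∷ _} refl refl = refl

-- In coordinates where the first component of f is x ↦ g x₀, the kernel lies
-- in the hyperplane x₀ = 0, on which the other components are again surjective.
cyclicKernel : ∀ {m} (f : ℤ^ suc m → ℤ^ m) → Linear f → (∀ y → ∃[ x ] f x ≡ y) →
               ∃[ ℓ ] ℓ ≢ 0ᶻ × f ℓ ≡ 0ᶻ × (∀ x → f x ≡ 0ᶻ → ∃[ t ] x ≡ t ·ᶻ ℓ)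
cyclicKernel {zero} f F surj = 1ℤ ∷ [] , (λ ()) , f≡[] (f _) , λ where
    (t ∷ []) _ → t , cong (_∷ []) (sym (ℤ.*-identityʳ t))
  where
  f≡[] : (y : ℤ^ 0) → y ≡ []
  f≡[] [] = refl
cyclicKernel {suc m} f F surj with diagonalizeHead f F
... | U , g , eq = to U (0ℤ ∷ ℓ′) , ℓ≢0 , fℓ≡0 , generates
  where
  open ≡-Reasoning

  f≡ : ∀ x → head (f x) ≡ g ℤ.* head (from U x)
  f≡ x = trans (cong (head ∘ f) (sym (to∘from U x))) (eq (from U x))

  -- If `g` were 0, every value of `f` would have first component 0, and `(1 , 0 , ...)` would have
  -- no preimage.
  g≢0 : g ≢ 0ℤ
  g≢0 refl with surj (1ℤ ∷ 0ᶻ)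
  ... | x , fx≡1 with () ← trans (sym (cong head fx≡1)) (f≡ x)

  f′ : ℤ^ suc m → ℤ^ m
  f′ x = tail (f (to U (0ℤ ∷ x)))

  onHyperplane : ∀ x → head (f x) ≡ 0ℤ → x ≡ to U (0ℤ ∷ tail (from U x))
  onHyperplane x fx≡0 with ℤ.i*j≡0⇒i≡0∨j≡0 g (trans (sym (f≡ x)) fx≡0)
  ... | inj₁ g≡0 = ⊥-elim (g≢0 g≡0)
  ... | inj₂ h≡0 = trans (sym (to∘from U x)) (cong (to U) (head-tail-≡ h≡0 refl))

  surj′ : ∀ y → ∃[ x ] f′ x ≡ y
  surj′ y with surj (0ℤ ∷ y)
  ... | x , fx≡y = tail (from U x) ,
    trans (cong (tail ∘ f) (sym (onHyperplane x (cong head fx≡y)))) (cong tail fx≡y)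

  F∘U : Linear (λ x → f (to U (0ℤ ∷ x)))
  F∘U = ∘-linear F (∘-linear (to-linear U) 0∷-linear)

  rec = cyclicKernel f′ (∘-linear tail-linear F∘U) surj′

  ℓ′ = proj₁ rec

  ℓ≢0 : to U (0ℤ ∷ ℓ′) ≢ 0ᶻ
  ℓ≢0 ℓ≡0 = proj₁ (proj₂ rec) (∷-injectiveʳ (begin
    0ℤ ∷ ℓ′                  ≡⟨ from∘to U _ ⟨
    from U (to U (0ℤ ∷ ℓ′))  ≡⟨ cong (from U) (trans ℓ≡0 (sym (0-homo (to-linear U)))) ⟩
    from U (to U 0ᶻ)         ≡⟨ from∘to U _ ⟩
    0ᶻ                       ∎))

  fℓ≡0 : f (to U (0ℤ ∷ ℓ′)) ≡ 0ᶻ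
  fℓ≡0 = head-tail-≡ (trans (eq _) (ℤ.*-zeroʳ g)) (proj₁ (proj₂ (proj₂ rec)))

  generates : ∀ x → f x ≡ 0ᶻ → ∃[ t ] x ≡ t ·ᶻ to U (0ℤ ∷ ℓ′)
  generates x fx≡0 with onHyperplane x (cong head fx≡0)
  ... | x≡ with proj₂ (proj₂ (proj₂ rec)) (tail (from U x))
                  (trans (cong (tail ∘ f) (sym x≡)) (cong tail fx≡0))
  ...   | t , x′≡tℓ′ = t , (begin
    x                              ≡⟨ x≡ ⟩
    to U (0ℤ ∷ tail (from U x))    ≡⟨ cong (to U ∘ (0ℤ ∷_)) x′≡tℓ′ ⟩
    to U (0ℤ ∷ t ·ᶻ ℓ′)            ≡⟨ cong (to U) (·-homo 0∷-linear t ℓ′) ⟩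
    to U (t ·ᶻ (0ℤ ∷ ℓ′))          ≡⟨ ·-homo (to-linear U) t _ ⟩
    t ·ᶻ to U (0ℤ ∷ ℓ′)            ∎)

-- Lists without repetitions and compositions

length-mono-⊆ : ∀ {xs ys : List X} → Uniqueₗ xs → (∀ {x} → x ∈ xs → x ∈ ys) → length xs ≤ length ys
length-mono-⊆ {xs = List.[]} _ _ = z≤n
length-mono-⊆ {xs = x List.∷ xs} xs! xs⊆ys with ∈-∃++ (xs⊆ys (here refl))
... | as , bs , refl = begin
  suc (length xs)                   ≤⟨ s≤s (length-mono-⊆ (tail! xs!) rest⊆) ⟩
  suc (length (as List.++ bs))      ≡⟨ List.length-++-sucʳ as x bs ⟨
  length (as List.++ x List.∷ bs)   ∎
  where
  open ℕ.≤-Reasoning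
  tail! : ∀ {x} {xs : List X} → Uniqueₗ (x List.∷ xs) → Uniqueₗ xs
  tail! (_ ∷ xs!) = xs!
  rest⊆ : ∀ {y} → y ∈ xs → y ∈ as List.++ bs
  rest⊆ y∈xs with ∈-++⁻ as (xs⊆ys (there y∈xs))
  ... | inj₁ y∈as          = ∈-++⁺ˡ y∈as
  ... | inj₂ (here refl)   = contradiction y∈xs (Unique.Unique[x∷xs]⇒x∉xs xs!)
  ... | inj₂ (there y∈bs)  = ∈-++⁺ʳ as y∈bs

length-≡-set : ∀ {xs ys : List X} → Uniqueₗ xs → Uniqueₗ ys →
               (∀ {x} → x ∈ xs → x ∈ ys) → (∀ {x} → x ∈ ys → x ∈ xs) → length xs ≡ length ys
length-≡-set xs! ys! f g = ℕ.≤-antisym (length-mono-⊆ xs! f) (length-mono-⊆ ys! g)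

length-filter-¬ : ∀ {P : Pred X 0ℓ} (P? : Decidable P) xs →
                  length (filter (¬? ∘ P?) xs) + length (filter P? xs) ≡ length xs
length-filter-¬ P? List.[] = refl
length-filter-¬ P? (x List.∷ xs) with P? x
... | yes _ = trans (ℕ.+-suc _ _) (cong suc (length-filter-¬ P? xs))
... | no  _ = cong suc (length-filter-¬ P? xs)

-- Injectivity is asked only on the entries of the list, since `comb A ∘ ι` is injective only on
-- normal forms of a fixed sum.
unique-map : ∀ (f : X → Y) {xs} → Uniqueₗ xs →
             (∀ {x y} → x ∈ xs → y ∈ xs → f x ≡ f y → x ≡ y) → Uniqueₗ (List.map f xs)
unique-map f {List.[]} _ _ = []
unique-map f {x List.∷ xs} (x∉ ∷ xs!) inj =
  All.tabulate (λ y∈ fx≡y → case-map y∈ fx≡y) ∷ unique-map f xs! (λ p q → inj (there p) (there q))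
  where
  case-map : ∀ {y} → y ∈ List.map f xs → f x ≢ y
  case-map y∈ fx≡y with ∈-map⁻ f y∈
  ... | z , z∈ , refl = All.lookup x∉ z∈ (inj (here refl) (there z∈) fx≡y)

card-≤ : ∀ {xs ys : List (ℤ^ d)} → Uniqueₗ xs → (∀ {x} → x ∈ xs → x ∈ ys) → length xs ≤ card ys
card-≤ xs! xs⊆ys = length-mono-⊆ xs! (∈-deduplicate⁺ _≟ᶻ_ ∘ xs⊆ys)

card-≥ : ∀ {xs ys : List (ℤ^ d)} → (∀ {x} → x ∈ ys → x ∈ xs) → card ys ≤ length xs
card-≥ {ys = ys} ys⊆xs = length-mono-⊆ (UniqueDec.deduplicate-! _≟ᶻ_ ys) (ys⊆xs ∘ ∈-deduplicate⁻ _≟ᶻ_ ys)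

-- Componentwise order on vectors of natural numbers, and compositions

infixl 6 _+ⁿ_
_+ⁿ_ : Vec ℕ n → Vec ℕ n → Vec ℕ n
_+ⁿ_ = zipWith _+_

infix 4 _≼_ _≼?_
_≼_ : Vec ℕ n → Vec ℕ n → Set
_≼_ = Pointwise _≤_

_≼?_ : (x y : Vec ℕ n) → _
_≼?_ = Pointwise.decidable {_∼_ = _≤_} ℕ._≤?_

sum-+ⁿ : (x y : Vec ℕ n) → sum (x +ⁿ y) ≡ sum x + sum y
sum-+ⁿ []      []      = refl
sum-+ⁿ (a ∷ x) (b ∷ y) = trans (cong ((a + b) ℕ.+_) (sum-+ⁿ x y)) (interchange ℕ.+-commutativeSemigroup a b (sum x) (sum y))

≼-+ⁿ : (x y : Vec ℕ n) → x ≼ x +ⁿ y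
≼-+ⁿ []      []      = []
≼-+ⁿ (a ∷ x) (b ∷ y) = ℕ.m≤m+n a b ∷ ≼-+ⁿ x y

≼⇒∃+ⁿ : ∀ {x y : Vec ℕ n} → x ≼ y → ∃[ z ] y ≡ x +ⁿ z
≼⇒∃+ⁿ []        = [] , refl
≼⇒∃+ⁿ (p ∷ x≼y) with ≼⇒∃+ⁿ x≼y
... | z , refl = _ , cong (_∷ _) (sym (ℕ.m+[n∸m]≡n p))

+ⁿ-cancelˡ : ∀ (x : Vec ℕ n) {y z} → x +ⁿ y ≡ x +ⁿ z → y ≡ z
+ⁿ-cancelˡ []      {[]}    {[]}    _  = refl
+ⁿ-cancelˡ (a ∷ x) {_ ∷ _} {_ ∷ _} eq =
  cong₂ _∷_ (ℕ.+-cancelˡ-≡ a _ _ (∷-injectiveˡ eq)) (+ⁿ-cancelˡ x (∷-injectiveʳ eq))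

sucHead : Vec ℕ (suc n) → Vec ℕ (suc n)
sucHead (a ∷ x) = suc a ∷ x

-- Zero parts are allowed. Splitting on whether the first part is zero makes the
-- number of compositions satisfy Pascal's rule.
compositions : ∀ n → ℕ → List (Vec ℕ n)
compositions zero    zero    = List.[ [] ]
compositions zero    (suc h) = List.[]
compositions (suc n) zero    = List.[ replicate _ 0 ]
compositions (suc n) (suc h) =
  List.map (0 ∷_) (compositions n (suc h)) List.++ List.map sucHead (compositions (suc n) h)

sum-replicate-0 : ∀ n → sum (replicate n 0) ≡ 0
sum-replicate-0 zero    = refl
sum-replicate-0 (suc n) = sum-replicate-0 n

sum≡0⇒≡replicate : ∀ {x : Vec ℕ n} → sum x ≡ 0 → x ≡ replicate n 0
sum≡0⇒≡replicate {x = []}       _  = refl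
sum≡0⇒≡replicate {x = zero ∷ x} eq = cong (0 ∷_) (sum≡0⇒≡replicate eq)

∈-compositions⁺ : ∀ {h} {x : Vec ℕ n} → sum x ≡ h → x ∈ compositions n h
∈-compositions⁺ {h = zero}  {[]}        _    = here refl
∈-compositions⁺ {h = zero}  {a ∷ x}     eq   = here (sum≡0⇒≡replicate eq)
∈-compositions⁺ {h = suc h} {zero ∷ x}  eq   = ∈-++⁺ˡ (∈-map⁺ (0 ∷_) (∈-compositions⁺ eq))
∈-compositions⁺ {suc n} {suc h} {suc a ∷ x} eq   =
  ∈-++⁺ʳ (List.map (0 ∷_) (compositions n (suc h))) (∈-map⁺ sucHead (∈-compositions⁺ (ℕ.suc-injective eq)))

∈-compositions⁻ : ∀ h {x : Vec ℕ n} → x ∈ compositions n h → sum x ≡ h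
∈-compositions⁻ {zero}  zero (here refl) = refl
∈-compositions⁻ {suc n} zero (here refl) = sum-replicate-0 n
∈-compositions⁻ {suc n} (suc h) x∈ with ∈-++⁻ (List.map (0 ∷_) (compositions n (suc h))) x∈
... | inj₁ x∈₁ with ∈-map⁻ (0 ∷_) x∈₁
...   | _ , y∈ , refl = ∈-compositions⁻ (suc h) y∈
∈-compositions⁻ {suc n} (suc h) x∈ | inj₂ x∈₂ with ∈-map⁻ sucHead x∈₂
...   | _ ∷ _ , y∈ , refl = cong suc (∈-compositions⁻ h y∈)

compositions-unique : ∀ n h → Uniqueₗ (compositions n h)
compositions-unique zero    zero    = All.[] ∷ []
compositions-unique zero    (suc h) = []
compositions-unique (suc n) zero    = All.[] ∷ []
compositions-unique (suc n) (suc h) = Unique.++⁺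
  (Unique.map⁺ ∷-injectiveʳ (compositions-unique n (suc h)))
  (Unique.map⁺ sucHead-injective (compositions-unique (suc n) h))
  disjoint
  where
  sucHead-injective : ∀ {x y : Vec ℕ (suc n)} → sucHead x ≡ sucHead y → x ≡ y
  sucHead-injective {_ ∷ _} {_ ∷ _} refl = refl
  disjoint : ∀ {v} → ¬ (v ∈ List.map (0 ∷_) (compositions n (suc h)) × v ∈ List.map sucHead (compositions (suc n) h))
  disjoint (p , q) with ∈-map⁻ (0 ∷_) p | ∈-map⁻ sucHead q
  ... | _ , _ , refl | _ ∷ _ , _ , ()

length-compositions : ∀ k h → length (compositions (suc k) h) ≡ (h + k) C k
length-compositions k zero = sym (nCn≡1 k)
length-compositions k (suc h) = begin
  length (List.map (0 ∷_) (compositions k (suc h)) List.++ List.map sucHead (compositions (suc k) h))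
    ≡⟨ List.length-++ (List.map (0 ∷_) (compositions k (suc h))) ⟩
  length (List.map (0 ∷_) (compositions k (suc h))) + length (List.map sucHead (compositions (suc k) h))
    ≡⟨ cong₂ _+_ (List.length-map _ (compositions k (suc h))) (List.length-map _ (compositions (suc k) h)) ⟩
  length (compositions k (suc h)) + length (compositions (suc k) h)
    ≡⟨ cong (length (compositions k (suc h)) ℕ.+_) (length-compositions k h) ⟩
  length (compositions k (suc h)) + (h + k) C k
    ≡⟨ pascal k ⟩
  (suc h + k) C k ∎
  where
  open ≡-Reasoning
  -- For `k = 0` there is no composition of a positive number into zero parts, and both sides are 1.
  pascal : ∀ k → length (compositions k (suc h)) + (h + k) C k ≡ (suc h + k) C k
  pascal zero = refl
  pascal (suc k) = begin
    length (compositions (suc k) (suc h)) + (h + suc k) C suc k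
      ≡⟨ cong₂ (λ a m → a + m C suc k) (length-compositions k (suc h)) (ℕ.+-suc h k) ⟩
    (suc h + k) C k + (suc h + k) C suc k
      ≡⟨ nCk+nC[k+1]≡[n+1]C[k+1] (suc h + k) k ⟩
    suc (suc h + k) C suc k
      ≡⟨ cong (λ m → suc m C suc k) (ℕ.+-suc h k) ⟨
    (suc h + suc k) C suc k ∎

-- Sumsets as sets of integral combinations

+ᶻ-comm : (x y : ℤ^ d) → x +ᶻ y ≡ y +ᶻ x
+ᶻ-comm []      []      = refl
+ᶻ-comm (a ∷ x) (b ∷ y) = cong₂ _∷_ (ℤ.+-comm a b) (+ᶻ-comm x y)

+ᶻ-assoc : (x y z : ℤ^ d) → (x +ᶻ y) +ᶻ z ≡ x +ᶻ (y +ᶻ z)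
+ᶻ-assoc []      []      []      = refl
+ᶻ-assoc (a ∷ x) (b ∷ y) (c ∷ z) = cong₂ _∷_ (ℤ.+-assoc a b c) (+ᶻ-assoc x y z)

+ᶻ-identityʳ : (x : ℤ^ d) → x +ᶻ 0ᶻ ≡ x
+ᶻ-identityʳ x = trans (+ᶻ-comm x 0ᶻ) (+ᶻ-identityˡ x)

+ᶻ-interchange : (x y z w : ℤ^ d) → (x +ᶻ y) +ᶻ (z +ᶻ w) ≡ (x +ᶻ z) +ᶻ (y +ᶻ w)
+ᶻ-interchange []      []      []      []      = refl
+ᶻ-interchange (a ∷ x) (b ∷ y) (c ∷ z) (e ∷ w) = cong₂ _∷_ (lemma a b c e) (+ᶻ-interchange x y z w)
  where
  lemma : ∀ a b c e → (a ℤ.+ b) ℤ.+ (c ℤ.+ e) ≡ (a ℤ.+ c) ℤ.+ (b ℤ.+ e)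
  lemma = solve-∀

+ᶻ-cancelʳ : (x y z : ℤ^ d) → x +ᶻ z ≡ y +ᶻ z → x ≡ y
+ᶻ-cancelʳ []      []      []      _  = refl
+ᶻ-cancelʳ (a ∷ x) (b ∷ y) (c ∷ z) eq =
  cong₂ _∷_ (∙-cancelʳ ℤ.+-0-abelianGroup c a b (∷-injectiveˡ eq)) (+ᶻ-cancelʳ x y z (∷-injectiveʳ eq))

x≡y+[x-y] : (x y : ℤ^ d) → x ≡ y +ᶻ (x -ᶻ y)
x≡y+[x-y] []      []      = refl
x≡y+[x-y] (a ∷ x) (b ∷ y) = cong₂ _∷_ (lemma a b) (x≡y+[x-y] x y)
  where
  lemma : ∀ a b → a ≡ b ℤ.+ (a ℤ.- b)
  lemma = solve-∀

·ᶻ-distribˡ : ∀ k (x y : ℤ^ d) → k ·ᶻ (x +ᶻ y) ≡ k ·ᶻ x +ᶻ k ·ᶻ y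
·ᶻ-distribˡ k []      []      = refl
·ᶻ-distribˡ k (a ∷ x) (b ∷ y) = cong₂ _∷_ (ℤ.*-distribˡ-+ k a b) (·ᶻ-distribˡ k x y)

·ᶻ-distribʳ : ∀ k l (x : ℤ^ d) → (k ℤ.+ l) ·ᶻ x ≡ k ·ᶻ x +ᶻ l ·ᶻ x
·ᶻ-distribʳ k l []      = refl
·ᶻ-distribʳ k l (a ∷ x) = cong₂ _∷_ (ℤ.*-distribʳ-+ a k l) (·ᶻ-distribʳ k l x)

·ᶻ-assoc : ∀ k l (x : ℤ^ d) → (k ℤ.* l) ·ᶻ x ≡ k ·ᶻ (l ·ᶻ x)
·ᶻ-assoc k l []      = refl
·ᶻ-assoc k l (a ∷ x) = cong₂ _∷_ (ℤ.*-assoc k l a) (·ᶻ-assoc k l x)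

·ᶻ-identityˡ : (x : ℤ^ d) → 1ℤ ·ᶻ x ≡ x
·ᶻ-identityˡ []      = refl
·ᶻ-identityˡ (a ∷ x) = cong₂ _∷_ (ℤ.*-identityˡ a) (·ᶻ-identityˡ x)

x-y≡x+-1·y : (x y : ℤ^ d) → x -ᶻ y ≡ x +ᶻ -1ℤ ·ᶻ y
x-y≡x+-1·y []      []      = refl
x-y≡x+-1·y (a ∷ x) (b ∷ y) = cong₂ _∷_ (cong (λ t → a ℤ.+ t) (sym (ℤ.-1*i≡-i b))) (x-y≡x+-1·y x y)

-x≡-1·x : (x : ℤ^ d) → -ᶻ x ≡ -1ℤ ·ᶻ x
-x≡-1·x []      = refl
-x≡-1·x (a ∷ x) = cong₂ _∷_ (sym (ℤ.-1*i≡-i a)) (-x≡-1·x x)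

comb : Vec (ℤ^ d) n → ℤ^ n → ℤ^ d
comb []      []      = 0ᶻ
comb (a ∷ A) (k ∷ c) = k ·ᶻ a +ᶻ comb A c

-- Homogeneous coordinates: the points of A are lifted to height 1.
comb⁺ : Vec (ℤ^ d) n → ℤ^ n → ℤ^ suc d
comb⁺ A c = foldr′ ℤ._+_ 0ℤ c ∷ comb A c

comb-linear : (A : Vec (ℤ^ d) n) → Linear (comb A)
comb-linear []      .Linear.+-homo [] []             = sym (+ᶻ-identityˡ 0ᶻ)
comb-linear (a ∷ A) .Linear.+-homo (k ∷ x) (l ∷ y)   =
  trans (cong₂ _+ᶻ_ (·ᶻ-distribʳ k l a) (Linear.+-homo (comb-linear A) x y)) (+ᶻ-interchange _ _ _ _)
comb-linear []      .Linear.·-homo k []              = sym (·ᶻ-zeroʳ _ k)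
comb-linear (a ∷ A) .Linear.·-homo k (l ∷ x)         =
  trans (cong₂ _+ᶻ_ (·ᶻ-assoc k l a) (Linear.·-homo (comb-linear A) k x)) (sym (·ᶻ-distribˡ k _ _))

Σ-+ : (x y : ℤ^ n) → foldr′ ℤ._+_ 0ℤ (x +ᶻ y) ≡ foldr′ ℤ._+_ 0ℤ x ℤ.+ foldr′ ℤ._+_ 0ℤ y
Σ-+ []      []      = refl
Σ-+ (a ∷ x) (b ∷ y) = trans (cong (λ t → a ℤ.+ b ℤ.+ t) (Σ-+ x y)) (lemma a b _ _)
  where
  lemma : ∀ a b c e → (a ℤ.+ b) ℤ.+ (c ℤ.+ e) ≡ (a ℤ.+ c) ℤ.+ (b ℤ.+ e)
  lemma = solve-∀

Σ-· : ∀ k (x : ℤ^ n) → foldr′ ℤ._+_ 0ℤ (k ·ᶻ x) ≡ k ℤ.* foldr′ ℤ._+_ 0ℤ x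
Σ-· k []      = sym (ℤ.*-zeroʳ k)
Σ-· k (a ∷ x) = trans (cong (λ t → k ℤ.* a ℤ.+ t) (Σ-· k x)) (sym (ℤ.*-distribˡ-+ k a _))

comb⁺-linear : (A : Vec (ℤ^ d) n) → Linear (comb⁺ A)
comb⁺-linear A .Linear.+-homo x y = cong₂ _∷_ (Σ-+ x y) (Linear.+-homo (comb-linear A) x y)
comb⁺-linear A .Linear.·-homo k x = cong₂ _∷_ (Σ-· k x) (Linear.·-homo (comb-linear A) k x)

-ᶻ-homo : ∀ {m n} {f : ℤ^ m → ℤ^ n} → Linear f → ∀ x y → f (x -ᶻ y) ≡ f x -ᶻ f y
-ᶻ-homo {f = f} F x y = begin
  f (x -ᶻ y)            ≡⟨ cong f (x-y≡x+-1·y x y) ⟩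
  f (x +ᶻ -1ℤ ·ᶻ y)     ≡⟨ Linear.+-homo F x _ ⟩
  f x +ᶻ f (-1ℤ ·ᶻ y)   ≡⟨ cong (f x +ᶻ_) (Linear.·-homo F -1ℤ y) ⟩
  f x +ᶻ -1ℤ ·ᶻ f y     ≡⟨ x-y≡x+-1·y (f x) (f y) ⟨
  f x -ᶻ f y            ∎
  where open ≡-Reasoning

x-x≡0 : (x : ℤ^ d) → x -ᶻ x ≡ 0ᶻ
x-x≡0 []      = refl
x-x≡0 (a ∷ x) = cong₂ _∷_ (ℤ.+-inverseʳ a) (x-x≡0 x)

comb⁺-0∷ : ∀ (a : ℤ^ d) (A : Vec (ℤ^ d) n) c → comb⁺ (a ∷ A) (0ℤ ∷ c) ≡ comb⁺ A c
comb⁺-0∷ a A c = cong₂ _∷_ (ℤ.+-identityˡ _) (trans (cong (_+ᶻ comb A c) (·ᶻ-zeroˡ a)) (+ᶻ-identityˡ _))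

∈⇒comb⁺ : ∀ {a} {A : Vec (ℤ^ d) n} → a ∈ᵛ A → ∃[ c ] comb⁺ A c ≡ 1ℤ ∷ a
∈⇒comb⁺ {A = a ∷ A} (here refl) = 1ℤ ∷ 0ᶻ , cong₂ _∷_
  (cong (λ t → 1ℤ ℤ.+ t) (∷-injectiveˡ (Linear.0-homo (comb⁺-linear A))))
  (trans (cong₂ _+ᶻ_ (·ᶻ-identityˡ a) (Linear.0-homo (comb-linear A))) (+ᶻ-identityʳ a))
∈⇒comb⁺ {A = b ∷ A} (there a∈A) with ∈⇒comb⁺ a∈A
... | c , eq = 0ℤ ∷ c , trans (comb⁺-0∷ b A c) eq

-- Differences of points at height 1 have height 0, and height 0 survives sums and negatives, so
-- induction on the generation applies.
∈⟨⟩⇒comb⁺ : ∀ {A : Vec (ℤ^ d) n} {x} → ⟨ differenceSet A ⟩ x → ∃[ c ] comb⁺ A c ≡ 0ℤ ∷ x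
∈⟨⟩⇒comb⁺ {A = A} (gen (a , b , a∈A , b∈A , refl)) with ∈⇒comb⁺ a∈A | ∈⇒comb⁺ b∈A
... | c , eq | c′ , eq′ = c -ᶻ c′ , trans (-ᶻ-homo (comb⁺-linear A) c c′) (cong₂ _-ᶻ_ eq eq′)
∈⟨⟩⇒comb⁺ {A = A} ⟨_⟩.zero = 0ᶻ , Linear.0-homo (comb⁺-linear A)
∈⟨⟩⇒comb⁺ {A = A} (add p q) with ∈⟨⟩⇒comb⁺ p | ∈⟨⟩⇒comb⁺ q
... | c , eq | c′ , eq′ = c +ᶻ c′ , trans (Linear.+-homo (comb⁺-linear A) c c′) (cong₂ _+ᶻ_ eq eq′)
∈⟨⟩⇒comb⁺ {A = A} (neg {x} p) with ∈⟨⟩⇒comb⁺ p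
... | c , eq = -1ℤ ·ᶻ c , trans (Linear.·-homo (comb⁺-linear A) -1ℤ c)
                            (trans (cong (-1ℤ ·ᶻ_) eq) (cong (0ℤ ∷_) (sym (-x≡-1·x x))))

-- A multiple of one lifted point reaches the height `k`; the remaining error has height 0 and is a
-- combination because the differences generate.
comb⁺-surjective : (A : Vec (ℤ^ d) (suc n)) → Generates (differenceSet A) → ∀ y → ∃[ c ] comb⁺ A c ≡ y
comb⁺-surjective A@(a ∷ _) G (k ∷ x) with ∈⇒comb⁺ {A = A} (here refl) | ∈⟨⟩⇒comb⁺ (G (x -ᶻ k ·ᶻ a))
... | c , eq | c′ , eq′ = k ·ᶻ c +ᶻ c′ , (begin
  comb⁺ A (k ·ᶻ c +ᶻ c′)                     ≡⟨ Linear.+-homo (comb⁺-linear A) (k ·ᶻ c) c′ ⟩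
  comb⁺ A (k ·ᶻ c) +ᶻ comb⁺ A c′             ≡⟨ cong₂ _+ᶻ_ (Linear.·-homo (comb⁺-linear A) k c) eq′ ⟩
  k ·ᶻ comb⁺ A c +ᶻ (0ℤ ∷ x -ᶻ k ·ᶻ a)       ≡⟨ cong (λ v → k ·ᶻ v +ᶻ (0ℤ ∷ x -ᶻ k ·ᶻ a)) eq ⟩
  (k ℤ.* 1ℤ ℤ.+ 0ℤ) ∷ (k ·ᶻ a +ᶻ (x -ᶻ k ·ᶻ a))
    ≡⟨ cong₂ _∷_ (trans (ℤ.+-identityʳ _) (ℤ.*-identityʳ k)) (sym (x≡y+[x-y] x (k ·ᶻ a))) ⟩
  k ∷ x                                      ∎)
  where open ≡-Reasoning

ι : Vec ℕ n → ℤ^ n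
ι = map (λ k → + k)

ι-+ : (x y : Vec ℕ n) → ι (x +ⁿ y) ≡ ι x +ᶻ ι y
ι-+ []      []      = refl
ι-+ (_ ∷ x) (_ ∷ y) = cong (_ ∷_) (ι-+ x y)

ι-injective : {x y : Vec ℕ n} → ι x ≡ ι y → x ≡ y
ι-injective {x = []}    {[]}    _  = refl
ι-injective {x = _ ∷ _} {_ ∷ _} eq = cong₂ _∷_ (ℤ.+-injective (∷-injectiveˡ eq)) (ι-injective (∷-injectiveʳ eq))

Σ-ι : (x : Vec ℕ n) → foldr′ ℤ._+_ 0ℤ (ι x) ≡ + sum x
Σ-ι []      = refl
Σ-ι (a ∷ x) = cong (λ t → + a ℤ.+ t) (Σ-ι x)

sumset-mono : ∀ h {a : ℤ^ d} {A : Vec (ℤ^ d) n} {x} → x ∈ sumset h A → x ∈ sumset h (a ∷ A)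
sumset-mono zero    x∈ = x∈
sumset-mono (suc h) {a} {A} x∈ with ∈-cartesianProductWith⁻ _+ᶻ_ (toList A) (sumset h A) x∈
... | _ , _ , b∈ , y∈ , refl = ∈-cartesianProductWith⁺ _+ᶻ_ (there b∈) (sumset-mono h y∈)

∈-sumset⁺ : (A : Vec (ℤ^ d) n) (c : Vec ℕ n) → comb A (ι c) ∈ sumset (sum c) A
∈-sumset⁺ []      []      = here refl
∈-sumset⁺ (a ∷ A) (k ∷ c) = addHead k
  where
  step : ∀ k v → + suc k ·ᶻ a +ᶻ v ≡ a +ᶻ (+ k ·ᶻ a +ᶻ v)
  step k v = trans (cong (_+ᶻ v) (trans (·ᶻ-distribʳ 1ℤ (+ k) a) (cong (_+ᶻ + k ·ᶻ a) (·ᶻ-identityˡ a))))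
                   (+ᶻ-assoc a _ v)
  addHead : ∀ k → + k ·ᶻ a +ᶻ comb A (ι c) ∈ sumset (k + sum c) (a ∷ A)
  addHead zero = subst (_∈ sumset (sum c) (a ∷ A))
    (sym (trans (cong (_+ᶻ comb A (ι c)) (·ᶻ-zeroˡ a)) (+ᶻ-identityˡ _)))
    (sumset-mono (sum c) (∈-sumset⁺ A c))
  addHead (suc k) = subst (_∈ sumset (suc k + sum c) (a ∷ A)) (sym (step k _))
    (∈-cartesianProductWith⁺ _+ᶻ_ {xs = toList (a ∷ A)} (here refl) (addHead k))

increment : ∀ {a} {A : Vec (ℤ^ d) n} → a ∈ᵛ A → (c : Vec ℕ n) →
            ∃[ c′ ] sum c′ ≡ suc (sum c) × comb A (ι c′) ≡ a +ᶻ comb A (ι c)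
increment {a = a} (here refl) (k ∷ c) = suc k ∷ c , refl ,
  trans (cong (_+ᶻ _) (trans (·ᶻ-distribʳ 1ℤ (+ k) a) (cong (_+ᶻ + k ·ᶻ a) (·ᶻ-identityˡ a)))) (+ᶻ-assoc a _ _)
increment {a = a} {A = b ∷ A} (there a∈A) (k ∷ c) with increment a∈A c
... | c′ , s , e = k ∷ c′ , trans (cong (λ t → k + t) s) (ℕ.+-suc k _) , (begin
  + k ·ᶻ b +ᶻ comb A (ι c′)          ≡⟨ cong (+ k ·ᶻ b +ᶻ_) e ⟩
  + k ·ᶻ b +ᶻ (a +ᶻ comb A (ι c))    ≡⟨ +ᶻ-assoc _ a _ ⟨
  (+ k ·ᶻ b +ᶻ a) +ᶻ comb A (ι c)    ≡⟨ cong (_+ᶻ comb A (ι c)) (+ᶻ-comm _ a) ⟩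
  (a +ᶻ + k ·ᶻ b) +ᶻ comb A (ι c)    ≡⟨ +ᶻ-assoc a _ _ ⟩
  a +ᶻ (+ k ·ᶻ b +ᶻ comb A (ι c))    ∎)
  where open ≡-Reasoning

∈-sumset⁻ : ∀ h {A : Vec (ℤ^ d) n} {x} → x ∈ sumset h A → ∃[ c ] sum c ≡ h × comb A (ι c) ≡ x
∈-sumset⁻ {n = n} zero {A} (here refl) = replicate n 0 , sum-replicate-0 n ,
  trans (cong (comb A) (ι-0 n)) (Linear.0-homo (comb-linear A))
  where
  ι-0 : ∀ n → ι (replicate n 0) ≡ 0ᶻ
  ι-0 zero    = refl
  ι-0 (suc n) = cong (0ℤ ∷_) (ι-0 n)
∈-sumset⁻ (suc h) {A} x∈ with ∈-cartesianProductWith⁻ _+ᶻ_ (toList A) (sumset h A) x∈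
... | a , y , a∈ , y∈ , refl with ∈-sumset⁻ h y∈
...   | c , refl , refl with increment (∈-toList⁻ a∈) c
...     | c′ , s , e = c′ , s , e

-- Normal forms and the cardinality of sumsets

posPart negPart : ℤ → ℕ
posPart (+ k)    = k
posPart -[1+ k ] = 0
negPart (+ k)    = 0
negPart -[1+ k ] = suc k

ι-posPart : (x : ℤ^ n) → ι (map posPart x) ≡ x +ᶻ ι (map negPart x)
ι-posPart []             = refl
ι-posPart (+ k ∷ x)      = cong₂ _∷_ (sym (ℤ.+-identityʳ _)) (ι-posPart x)
ι-posPart (-[1+ k ] ∷ x) = cong₂ _∷_ (sym (ℤ.+-inverseˡ (+ suc k))) (ι-posPart x)

parts≡0⇒≡0 : ∀ (x : ℤ^ n) → sum (map posPart x) ≡ 0 → sum (map negPart x) ≡ 0 → x ≡ 0ᶻ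
parts≡0⇒≡0 []             _ _ = refl
parts≡0⇒≡0 (+ zero ∷ x)   p q = cong (0ℤ ∷_) (parts≡0⇒≡0 x p q)
parts≡0⇒≡0 (-[1+ _ ] ∷ x) p ()

_·ⁿ_ : Vec ℕ n → Vec ℕ n → ℕ
x ·ⁿ y = sum (zipWith _*_ x y)

·ⁿ-distribʳ : (z x y : Vec ℕ n) → (x +ⁿ y) ·ⁿ z ≡ x ·ⁿ z + y ·ⁿ z
·ⁿ-distribʳ []      []      []      = refl
·ⁿ-distribʳ (c ∷ z) (a ∷ x) (b ∷ y) =
  trans (cong₂ _+_ (ℕ.*-distribʳ-+ c a b) (·ⁿ-distribʳ z x y)) (interchange ℕ.+-commutativeSemigroup (a * c) (b * c) _ _)

-- Orthogonality is the form in which the disjointness of the supports is used: exchanging the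
-- positive part of a relation for its negative part lowers the product with the positive part.
negPart·posPart≡0 : (x : ℤ^ n) → map negPart x ·ⁿ map posPart x ≡ 0
negPart·posPart≡0 []             = refl
negPart·posPart≡0 (+ k ∷ x)      = negPart·posPart≡0 x
negPart·posPart≡0 (-[1+ k ] ∷ x) = trans (cong (λ t → t + map negPart x ·ⁿ map posPart x) (ℕ.*-zeroʳ k)) (negPart·posPart≡0 x)

sum≤·ⁿ : (x : Vec ℕ n) → sum x ≤ x ·ⁿ x
sum≤·ⁿ []          = z≤n
sum≤·ⁿ (zero ∷ x)  = sum≤·ⁿ x
sum≤·ⁿ (suc k ∷ x) = ℕ.+-mono-≤ (ℕ.m≤m*n (suc k) (suc k)) (sum≤·ⁿ x)

≼-sum : {x y : Vec ℕ n} → x ≼ y → sum x ≤ sum y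
≼-sum []      = z≤n
≼-sum (p ∷ q) = ℕ.+-mono-≤ p (≼-sum q)

-- Where an entry of `x` is positive, adding it at least once to a nonnegative number already gives
-- at least that entry; elsewhere the positive part is 0.
posPart-≼ : ∀ (c c′ : Vec ℕ n) (x : ℤ^ n) k → ι c ≡ ι c′ +ᶻ + suc k ·ᶻ x → map posPart x ≼ c
posPart-≼ []      []       []      k _  = []
posPart-≼ (a ∷ c) (b ∷ c′) (i ∷ x) k eq = bound i (∷-injectiveˡ eq) ∷ posPart-≼ c c′ x k (∷-injectiveʳ eq)
  where
  bound : ∀ i → + a ≡ + b ℤ.+ + suc k ℤ.* i → posPart i ≤ a
  bound (+ p) e = begin
    p              ≤⟨ ℕ.m≤m+n p (k * p) ⟩
    suc k * p      ≤⟨ ℕ.m≤n+m _ b ⟩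
    b + suc k * p  ≡⟨ ℤ.+-injective (trans e (cong (λ t → + b ℤ.+ t) (sym (ℤ.pos-* (suc k) p)))) ⟨
    a              ∎
    where open ℕ.≤-Reasoning
  bound -[1+ _ ] e = z≤n

-- The kernel of comb⁺ A is generated by ℓ = P - Q, where P and Q have disjoint
-- supports. Hence every fibre of comb⁺ A ∘ ι contains exactly one c with ¬ P ≼ c.
module Relation
  (A : Vec (ℤ^ d) n) (ℓ : ℤ^ n) (ℓ≢0 : ℓ ≢ 0ᶻ) (ℓ∈ker : comb⁺ A ℓ ≡ 0ᶻ)
  (kernel : ∀ x → comb⁺ A x ≡ 0ᶻ → ∃[ t ] x ≡ t ·ᶻ ℓ)
  where

  P Q : Vec ℕ n
  P = map posPart ℓ
  Q = map negPart ℓ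

  D : ℕ
  D = sum P

  comb⁺-P : comb⁺ A (ι P) ≡ comb⁺ A (ι Q)
  comb⁺-P = begin
    comb⁺ A (ι P)                  ≡⟨ cong (comb⁺ A) (ι-posPart ℓ) ⟩
    comb⁺ A (ℓ +ᶻ ι Q)             ≡⟨ Linear.+-homo (comb⁺-linear A) ℓ _ ⟩
    comb⁺ A ℓ +ᶻ comb⁺ A (ι Q)     ≡⟨ cong (_+ᶻ comb⁺ A (ι Q)) ℓ∈ker ⟩
    0ᶻ +ᶻ comb⁺ A (ι Q)            ≡⟨ +ᶻ-identityˡ _ ⟩
    comb⁺ A (ι Q)                  ∎
    where open ≡-Reasoning

  -- The coefficients of `ℓ` sum to 0: this is the height coordinate of the relation.
  sum-Q : sum Q ≡ D
  sum-Q = ℤ.+-injective (begin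
    + sum Q                     ≡⟨ Σ-ι Q ⟨
    foldr′ ℤ._+_ 0ℤ (ι Q)       ≡⟨ ∷-injectiveˡ comb⁺-P ⟨
    foldr′ ℤ._+_ 0ℤ (ι P)       ≡⟨ Σ-ι P ⟩
    + D                         ∎)
    where open ≡-Reasoning

  D>0 : 0 < D
  D>0 = ℕ.n≢0⇒n>0 (λ D≡0 → ℓ≢0 (parts≡0⇒≡0 ℓ D≡0 (trans sum-Q D≡0)))

  -- As long as `c` contains `P`, exchange `P` for `Q`, which changes neither the point nor the
  -- number of summands. The product with `P` serves as the measure: `Q` is orthogonal to `P`, while
  -- `P ·ⁿ P` is positive.
  normalize : ∀ c → ∃[ c′ ] ¬ P ≼ c′ × sum c′ ≡ sum c × comb A (ι c′) ≡ comb A (ι c)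
  normalize c = go c (ℕ.<-wellFounded (c ·ⁿ P))
    where
    go : ∀ c → Acc _<_ (c ·ⁿ P) → ∃[ c′ ] ¬ P ≼ c′ × sum c′ ≡ sum c × comb A (ι c′) ≡ comb A (ι c)
    go c (acc rec) with P ≼? c
    ... | no  P⋠c = c , P⋠c , refl , refl
    ... | yes P≼c with ≼⇒∃+ⁿ P≼c
    ...   | m , refl with go (Q +ⁿ m) (rec smaller)
      where
      smaller : (Q +ⁿ m) ·ⁿ P < (P +ⁿ m) ·ⁿ P
      smaller = begin-strict
        (Q +ⁿ m) ·ⁿ P      ≡⟨ ·ⁿ-distribʳ P Q m ⟩
        Q ·ⁿ P + m ·ⁿ P    ≡⟨ cong (λ t → t + m ·ⁿ P) (negPart·posPart≡0 ℓ) ⟩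
        m ·ⁿ P             <⟨ ℕ.+-monoˡ-< (m ·ⁿ P) (ℕ.<-≤-trans D>0 (sum≤·ⁿ P)) ⟩
        P ·ⁿ P + m ·ⁿ P    ≡⟨ ·ⁿ-distribʳ P P m ⟨
        (P +ⁿ m) ·ⁿ P      ∎
        where open ℕ.≤-Reasoning
    ...     | c′ , normal , sum≡ , comb≡ = c′ , normal , trans sum≡ sums , trans comb≡ combs
      where
      open ≡-Reasoning
      sums : sum (Q +ⁿ m) ≡ sum (P +ⁿ m)
      sums = begin
        sum (Q +ⁿ m)   ≡⟨ sum-+ⁿ Q m ⟩
        sum Q + sum m  ≡⟨ cong (λ t → t + sum m) sum-Q ⟩
        sum P + sum m  ≡⟨ sum-+ⁿ P m ⟨
        sum (P +ⁿ m)   ∎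
      combs : comb A (ι (Q +ⁿ m)) ≡ comb A (ι (P +ⁿ m))
      combs = begin
        comb A (ι (Q +ⁿ m))             ≡⟨ cong (comb A) (ι-+ Q m) ⟩
        comb A (ι Q +ᶻ ι m)             ≡⟨ Linear.+-homo (comb-linear A) _ _ ⟩
        comb A (ι Q) +ᶻ comb A (ι m)    ≡⟨ cong (_+ᶻ comb A (ι m)) (∷-injectiveʳ comb⁺-P) ⟨
        comb A (ι P) +ᶻ comb A (ι m)    ≡⟨ Linear.+-homo (comb-linear A) _ _ ⟨
        comb A (ι P +ᶻ ι m)             ≡⟨ cong (comb A) (ι-+ P m) ⟨
        comb A (ι (P +ⁿ m))             ∎

  -- Two representations differ by `t ·ᶻ ℓ`. For positive `t` the first would contain `P`, for
  -- negative `t` the second would.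
  normal-injective : ∀ {c c′} → ¬ P ≼ c → ¬ P ≼ c′ → comb⁺ A (ι c) ≡ comb⁺ A (ι c′) → c ≡ c′
  normal-injective {c} {c′} P⋠c P⋠c′ eq
    with kernel (ι c -ᶻ ι c′) (trans (-ᶻ-homo (comb⁺-linear A) _ _)
           (trans (cong (_-ᶻ comb⁺ A (ι c′)) eq) (x-x≡0 (comb⁺ A (ι c′)))))
  ... | t , e = cases t (trans (x≡y+[x-y] (ι c) (ι c′)) (cong (ι c′ +ᶻ_) e))
    where
    open ≡-Reasoning
    cases : ∀ t → ι c ≡ ι c′ +ᶻ t ·ᶻ ℓ → c ≡ c′
    cases (+ zero)  e = ι-injective (trans e (trans (cong (ι c′ +ᶻ_) (·ᶻ-zeroˡ ℓ)) (+ᶻ-identityʳ _)))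
    cases (+ suc k) e = contradiction (posPart-≼ c c′ ℓ k e) P⋠c
    cases -[1+ k ]  e = contradiction (posPart-≼ c′ c ℓ k (begin
      ι c′                                            ≡⟨ +ᶻ-identityʳ _ ⟨
      ι c′ +ᶻ 0ᶻ                                      ≡⟨ cong (ι c′ +ᶻ_) (·ᶻ-zeroˡ ℓ) ⟨
      ι c′ +ᶻ 0ℤ ·ᶻ ℓ                                 ≡⟨ cong (λ t → ι c′ +ᶻ t ·ᶻ ℓ) (ℤ.+-inverseˡ (+ suc k)) ⟨
      ι c′ +ᶻ (-[1+ k ] ℤ.+ + suc k) ·ᶻ ℓ             ≡⟨ cong (ι c′ +ᶻ_) (·ᶻ-distribʳ -[1+ k ] (+ suc k) ℓ) ⟩
      ι c′ +ᶻ (-[1+ k ] ·ᶻ ℓ +ᶻ + suc k ·ᶻ ℓ)         ≡⟨ +ᶻ-assoc _ _ _ ⟨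
      (ι c′ +ᶻ -[1+ k ] ·ᶻ ℓ) +ᶻ + suc k ·ᶻ ℓ         ≡⟨ cong (_+ᶻ + suc k ·ᶻ ℓ) e ⟨
      ι c +ᶻ + suc k ·ᶻ ℓ                             ∎)) P⋠c′

  normals : ℕ → List (Vec ℕ n)
  normals h = filter (¬? ∘ (P ≼?_)) (compositions n h)

  card-sumset≡normals : ∀ h → card (sumset h A) ≡ length (normals h)
  card-sumset≡normals h = ℕ.≤-antisym
    (ℕ.≤-trans (card-≥ covers) (ℕ.≤-reflexive (List.length-map _ (normals h))))
    (ℕ.≤-trans (ℕ.≤-reflexive (sym (List.length-map _ (normals h)))) (card-≤ images! images⊆))
    where
    images : List (ℤ^ d)
    images = List.map (comb A ∘ ι) (normals h)

    covers : ∀ {x} → x ∈ sumset h A → x ∈ images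
    covers x∈ with ∈-sumset⁻ h x∈
    ... | c , refl , refl with normalize c
    ...   | c′ , normal , sum≡ , comb≡ = subst (_∈ images) comb≡
      (∈-map⁺ (comb A ∘ ι) (∈-filter⁺ (¬? ∘ (P ≼?_)) (∈-compositions⁺ sum≡) normal))

    images⊆ : ∀ {x} → x ∈ images → x ∈ sumset h A
    images⊆ x∈ with ∈-map⁻ (comb A ∘ ι) x∈
    ... | c , c∈ , refl = subst (λ h → comb A (ι c) ∈ sumset h A)
      (∈-compositions⁻ h (proj₁ (∈-filter⁻ (¬? ∘ (P ≼?_)) {xs = compositions n h} c∈))) (∈-sumset⁺ A c)

    images! : Uniqueₗ images
    images! = unique-map (comb A ∘ ι) (Unique.filter⁺ (¬? ∘ (P ≼?_)) (compositions-unique n h)) injective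
      where
      injective : ∀ {c c′} → c ∈ normals h → c′ ∈ normals h → comb A (ι c) ≡ comb A (ι c′) → c ≡ c′
      injective {c} {c′} c∈ c′∈ eq
        with ∈-filter⁻ (¬? ∘ (P ≼?_)) {xs = compositions n h} c∈
           | ∈-filter⁻ (¬? ∘ (P ≼?_)) {xs = compositions n h} c′∈
      ... | c∈′ , normal | c′∈′ , normal′ = normal-injective normal normal′ (cong₂ _∷_ (begin
        foldr′ ℤ._+_ 0ℤ (ι c)   ≡⟨ Σ-ι c ⟩
        + sum c                 ≡⟨ cong (λ k → + k) (∈-compositions⁻ h c∈′) ⟩
        + h                     ≡⟨ cong (λ k → + k) (∈-compositions⁻ h c′∈′) ⟨
        + sum c′                ≡⟨ Σ-ι c′ ⟨
        foldr′ ℤ._+_ 0ℤ (ι c′)  ∎) eq)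
        where open ≡-Reasoning

  reducibles : ℕ → List (Vec ℕ n)
  reducibles h = filter (P ≼?_) (compositions n h)

  reducibles! : ∀ h → Uniqueₗ (reducibles h)
  reducibles! h = Unique.filter⁺ (P ≼?_) (compositions-unique n h)

  length-reducibles-< : ∀ {h} → h < D → length (reducibles h) ≡ 0
  length-reducibles-< {h} h<D = ℕ.n≤0⇒n≡0 (length-mono-⊆ {ys = List.[]} (reducibles! h) none)
    where
    none : ∀ {c} → c ∈ reducibles h → c ∈ List.[]
    none c∈ with ∈-filter⁻ (P ≼?_) {xs = compositions n h} c∈
    ... | c∈′ , P≼c = contradiction (ℕ.≤-trans (≼-sum P≼c) (ℕ.≤-reflexive (∈-compositions⁻ h c∈′))) (ℕ.<⇒≱ h<D)

  -- Translation by `P` is a bijection from all compositions of `h` onto the reducible ones of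
  -- `D + h`.
  length-reducibles-+ : ∀ h → length (reducibles (D + h)) ≡ length (compositions n h)
  length-reducibles-+ h = trans
    (length-≡-set (reducibles! (D + h)) (Unique.map⁺ (+ⁿ-cancelˡ P) (compositions-unique n h)) subtract-P add-P)
    (List.length-map _ (compositions n h))
    where
    subtract-P : ∀ {c} → c ∈ reducibles (D + h) → c ∈ List.map (P +ⁿ_) (compositions n h)
    subtract-P c∈ with ∈-filter⁻ (P ≼?_) {xs = compositions n (D + h)} c∈
    ... | c∈′ , P≼c with ≼⇒∃+ⁿ P≼c
    ...   | m , refl = ∈-map⁺ (P +ⁿ_) (∈-compositions⁺
      (ℕ.+-cancelˡ-≡ D _ _ (trans (sym (sum-+ⁿ P m)) (∈-compositions⁻ (D + h) c∈′))))
    add-P : ∀ {c} → c ∈ List.map (P +ⁿ_) (compositions n h) → c ∈ reducibles (D + h)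
    add-P c∈ with ∈-map⁻ (P +ⁿ_) c∈
    ... | m , m∈ , refl = ∈-filter⁺ (P ≼?_)
      (∈-compositions⁺ (trans (sum-+ⁿ P m) (cong (λ t → D + t) (∈-compositions⁻ h m∈)))) (≼-+ⁿ P m)

  card-sumset+reducibles : ∀ h → card (sumset h A) + length (reducibles h) ≡ length (compositions n h)
  card-sumset+reducibles h =
    trans (cong (λ t → t + length (reducibles h)) (card-sumset≡normals h)) (length-filter-¬ (P ≼?_) (compositions n h))

  card-sumset-< : ∀ {h} → h < D → card (sumset h A) ≡ length (compositions n h)
  card-sumset-< {h} h<D = begin
    card (sumset h A)                          ≡⟨ ℕ.+-identityʳ _ ⟨
    card (sumset h A) + 0                      ≡⟨ cong (λ t → card (sumset h A) + t) (length-reducibles-< h<D) ⟨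
    card (sumset h A) + length (reducibles h)  ≡⟨ card-sumset+reducibles h ⟩
    length (compositions n h)                  ∎
    where open ≡-Reasoning

  card-sumset-+ : ∀ h → card (sumset (D + h) A) + length (compositions n h) ≡ length (compositions n (D + h))
  card-sumset-+ h = trans (cong (λ t → card (sumset (D + h) A) + t) (sym (length-reducibles-+ h)))
                          (card-sumset+reducibles (D + h))

-- Growth of differences of binomial coefficients

absorption : ∀ n k → (suc n C suc k) * suc k ≡ suc n * (n C k)
absorption n       zero    = trans (ℕ.*-identityʳ (suc n C 1)) (trans (nC1≡n (suc n)) (sym (ℕ.*-identityʳ (suc n))))
absorption zero    (suc k) = refl
absorption (suc n) (suc k) = begin
  (suc (suc n) C suc (suc k)) * suc (suc k)
    ≡⟨ cong (_* suc (suc k)) (nCk+nC[k+1]≡[n+1]C[k+1] (suc n) (suc k)) ⟨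
  (x + y) * suc (suc k)
    ≡⟨ expand x y k ⟩
  x * suc k + x + y * suc (suc k)
    ≡⟨ cong₂ (λ u v → u + x + v) (absorption n k) (absorption n (suc k)) ⟩
  suc n * (n C k) + x + suc n * (n C suc k)
    ≡⟨ collect (suc n) (n C k) x (n C suc k) ⟩
  x + suc n * ((n C k) + (n C suc k))
    ≡⟨ cong (λ t → x + suc n * t) (nCk+nC[k+1]≡[n+1]C[k+1] n k) ⟩
  suc (suc n) * (suc n C suc k) ∎
  where
  open ≡-Reasoning
  x = (suc n C suc k)
  y = (suc n C suc (suc k))
  expand : ∀ x y k → (x + y) * suc (suc k) ≡ x * suc k + x + y * suc (suc k)
  expand = ℕ-Solver.solve-∀
  collect : ∀ m a x b → m * a + x + m * b ≡ x + m * (a + b)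
  collect = ℕ-Solver.solve-∀

absorption-! : ∀ n k → (suc n C suc k) * suc k ! ≡ suc n * ((n C k) * k !)
absorption-! n k = begin
  (suc n C suc k) * (suc k * k !)  ≡⟨ ℕ.*-assoc (suc n C suc k) (suc k) (k !) ⟨
  (suc n C suc k) * suc k * k !    ≡⟨ cong (_* k !) (absorption n k) ⟩
  suc n * (n C k) * k !            ≡⟨ ℕ.*-assoc (suc n) (n C k) (k !) ⟩
  suc n * ((n C k) * k !)          ∎
  where open ≡-Reasoning

-- The left side is the falling factorial `n (n - 1) ... (n - k + 1)`, with `k` factors at most `n`.
C-upper : ∀ n k → (n C k) * k ! ≤ n ^ k
C-upper n       zero    = ℕ.≤-refl
C-upper zero    (suc k) = z≤n
C-upper (suc n) (suc k) = begin
  (suc n C suc k) * suc k !  ≡⟨ absorption-! n k ⟩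
  suc n * ((n C k) * k !)    ≤⟨ ℕ.*-monoʳ-≤ (suc n) (C-upper n k) ⟩
  suc n * n ^ k            ≤⟨ ℕ.*-monoʳ-≤ (suc n) (ℕ.^-monoˡ-≤ k (ℕ.n≤1+n n)) ⟩
  suc n * suc n ^ k        ∎
  where open ℕ.≤-Reasoning

-- The right side is the product `(n + 1) ... (n + k)`.
C-lower : ∀ n k → n ^ k ≤ ((k + n) C k) * k !
C-lower n zero    = ℕ.≤-refl
C-lower n (suc k) = begin
  n * n ^ k                            ≤⟨ ℕ.*-mono-≤ (ℕ.m≤n+m n (suc k)) (C-lower n k) ⟩
  suc (k + n) * (((k + n) C k) * k !)    ≡⟨ absorption-! (k + n) k ⟨
  (suc (k + n) C suc k) * suc k !        ∎
  where open ℕ.≤-Reasoning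

C-mono-suc : ∀ n k → (n C k) ≤ (suc n C k)
C-mono-suc n zero    = ℕ.≤-refl
C-mono-suc n (suc k) = begin
  (n C suc k)              ≤⟨ ℕ.m≤n+m _ (n C k) ⟩
  (n C k) + (n C suc k)      ≡⟨ nCk+nC[k+1]≡[n+1]C[k+1] n k ⟩
  (suc n C suc k)          ∎
  where open ℕ.≤-Reasoning

C-mono-+ : ∀ j n k → (n C k) ≤ ((j + n) C k)
C-mono-+ zero    n k = ℕ.≤-refl
C-mono-+ (suc j) n k = ℕ.≤-trans (C-mono-+ j n k) (C-mono-suc (j + n) k)

-- Iterating Pascal's rule writes the increment as a sum of `j` binomial coefficients `(n + i) C k`
-- with `i < j`. Bounding each by the largest argument gives this estimate, by the smallest the next
-- one.
C-increment-upper : ∀ j n k → ((j + n) C suc k) ≤ (n C suc k) + j * ((j + n) C k)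
C-increment-upper zero    n k = ℕ.m≤m+n _ 0
C-increment-upper (suc j) n k = begin
  (suc (j + n) C suc k)                        ≡⟨ nCk+nC[k+1]≡[n+1]C[k+1] (j + n) k ⟨
  c + ((j + n) C suc k)                        ≤⟨ ℕ.+-monoʳ-≤ c (C-increment-upper j n k) ⟩
  c + ((n C suc k) + j * c)                    ≡⟨ lemma c (n C suc k) j ⟩
  (n C suc k) + suc j * c                      ≤⟨ ℕ.+-monoʳ-≤ (n C suc k) (ℕ.*-monoʳ-≤ (suc j) (C-mono-suc (j + n) k)) ⟩
  (n C suc k) + suc j * (suc (j + n) C k)        ∎
  where
  open ℕ.≤-Reasoning
  c = ((j + n) C k)
  lemma : ∀ c b j → c + (b + j * c) ≡ b + suc j * c
  lemma = ℕ-Solver.solve-∀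

C-increment-lower : ∀ j n k → (n C suc k) + j * (n C k) ≤ ((j + n) C suc k)
C-increment-lower zero    n k = ℕ.≤-reflexive (ℕ.+-identityʳ _)
C-increment-lower (suc j) n k = begin
  (n C suc k) + suc j * (n C k)          ≡⟨ lemma (n C suc k) j (n C k) ⟩
  (n C k) + ((n C suc k) + j * (n C k))    ≤⟨ ℕ.+-mono-≤ (C-mono-+ j n k) (C-increment-lower j n k) ⟩
  ((j + n) C k) + ((j + n) C suc k)      ≡⟨ nCk+nC[k+1]≡[n+1]C[k+1] (j + n) k ⟩
  (suc (j + n) C suc k)                ∎
  where
  open ℕ.≤-Reasoning
  lemma : ∀ b j c → b + suc j * c ≡ c + (b + j * c)
  lemma = ℕ-Solver.solve-∀

-- With `s = suc m`, division by `s ^ suc d` gives Bernoulli's inequality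
-- `1 - d / s ≤ (1 - 1 / s)ᵈ`.
bernoulli : ∀ m d → suc m ^ suc d ≤ m ^ d * suc m + d * suc m ^ d
bernoulli m zero    = ℕ.≤-reflexive (lemma m)
  where
  lemma : ∀ m → suc m * 1 ≡ 1 * suc m + 0
  lemma = ℕ-Solver.solve-∀
bernoulli m (suc d) = begin
  s * s ^ suc d                              ≤⟨ ℕ.*-monoʳ-≤ s (bernoulli m d) ⟩
  s * (m ^ d * s + d * s ^ d)                ≡⟨ expand m (m ^ d) d (s ^ d) ⟩
  m * m ^ d * s + (m ^ d * s + d * (s * s ^ d))
    ≤⟨ ℕ.+-monoʳ-≤ (m * m ^ d * s) (ℕ.+-monoˡ-≤ _ (ℕ.≤-trans (ℕ.*-monoˡ-≤ s (ℕ.^-monoˡ-≤ d (ℕ.n≤1+n m))) (ℕ.≤-reflexive (ℕ.*-comm (s ^ d) s)))) ⟩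
  m * m ^ d * s + suc d * (s * s ^ d)        ∎
  where
  open ℕ.≤-Reasoning
  s = suc m
  expand : ∀ m x d y → suc m * (x * suc m + d * y) ≡ m * x * suc m + (x * suc m + d * (suc m * y))
  expand = ℕ-Solver.solve-∀

-- The ratio of `suc m ^ d` to `m ^ d` tends to 1. Since `a` and `b` are integers, one sufficiently
-- large `m` decides.
limit-≤ : ∀ {a b} d → (∀ m → a * m ^ d ≤ b * suc m ^ d) → a ≤ b
limit-≤ {a} {b} d bound with a ℕ.≤? b
... | yes a≤b = a≤b
... | no  a≰b = contradiction s≤m (ℕ.n≮n m)
  where
  open ℕ.≤-Reasoning
  -- With this value the error term of `suc b` times Bernoulli's inequality is exactly `m * s ^ d`.
  -- If `suc b ≤ a`, the main terms cancel and leave `s ≤ m`.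
  m = suc b * d
  s = suc m

  regroup : ∀ b s x y d → suc b * (x * s + d * y) ≡ (suc b * x) * s + suc b * d * y
  regroup = ℕ-Solver.solve-∀

  pull : ∀ b s y → b * y * s ≡ b * (s * y)
  pull = ℕ-Solver.solve-∀

  key : s ^ suc d + b * s ^ suc d ≤ m * s ^ d + b * s ^ suc d
  key = begin
    s ^ suc d + b * s ^ suc d                    ≤⟨ ℕ.*-monoʳ-≤ (suc b) (bernoulli m d) ⟩
    suc b * (m ^ d * s + d * s ^ d)              ≡⟨ regroup b s (m ^ d) (s ^ d) d ⟩
    suc b * m ^ d * s + m * s ^ d                ≤⟨ ℕ.+-monoˡ-≤ _ (ℕ.*-monoˡ-≤ s (ℕ.≤-trans (ℕ.*-monoˡ-≤ (m ^ d) (ℕ.≰⇒> a≰b)) (bound m))) ⟩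
    b * s ^ d * s + m * s ^ d                    ≡⟨ cong (_+ m * s ^ d) (pull b s (s ^ d)) ⟩
    b * s ^ suc d + m * s ^ d                    ≡⟨ ℕ.+-comm _ (m * s ^ d) ⟩
    m * s ^ d + b * s ^ suc d                    ∎

  s≤m : s ≤ m
  s≤m = ℕ.*-cancelʳ-≤ s m (s ^ d) {{ℕ.m^n≢0 s d}} (ℕ.+-cancelʳ-≤ (b * s ^ suc d) _ _ key)

^-distribʳ-* : ∀ d m n → (m * n) ^ d ≡ m ^ d * n ^ d
^-distribʳ-* zero    m n = refl
^-distribʳ-* (suc d) m n = trans (cong (m * n *_) (^-distribʳ-* d m n)) (interchange ℕ.*-commutativeSemigroup m n (m ^ d) (n ^ d))

-- Restricting to multiples of `c` makes one step of `m` wide enough to absorb an additive constant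
-- of size `c`.
limit-≤-scaled : ∀ {a b} c d .{{_ : NonZero c}} → (∀ m → a * (c * m) ^ d ≤ b * (c * suc m) ^ d) → a ≤ b
limit-≤-scaled {a} {b} c d bound = ℕ.*-cancelʳ-≤ a b (c ^ d) {{ℕ.m^n≢0 c d}} (limit-≤ d λ m → begin
  a * c ^ d * m ^ d          ≡⟨ split a m ⟩
  a * (c * m) ^ d            ≤⟨ bound m ⟩
  b * (c * suc m) ^ d        ≡⟨ split b (suc m) ⟨
  b * c ^ d * suc m ^ d      ∎)
  where
  open ℕ.≤-Reasoning
  split : ∀ x m → x * c ^ d * m ^ d ≡ x * (c * m) ^ d
  split x m = trans (ℕ.*-assoc x (c ^ d) (m ^ d)) (cong (x *_) (sym (^-distribʳ-* d c m)))

-- Both bounds reflect F h ~ D hᵈ / d! for the difference F of binomial coefficients.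
module Growth (d D : ℕ) .{{_ : NonZero D}} (F : ℕ → ℕ)
  (F≡ : ∀ h → F (D + h) + ((h + suc d) C suc d) ≡ ((D + (h + suc d)) C suc d)) where

  open ℕ.≤-Reasoning

  F-upper : ∀ h → d ! * F (D + h) ≤ D * (D + (h + suc d)) ^ d
  F-upper h = begin
    d ! * F (D + h)           ≤⟨ ℕ.*-monoʳ-≤ (d !) (ℕ.+-cancelʳ-≤ (m C suc d) _ _ (begin
      F (D + h) + (m C suc d)                ≡⟨ F≡ h ⟩
      ((D + m) C suc d)                      ≤⟨ C-increment-upper D m d ⟩
      (m C suc d) + D * ((D + m) C d)          ≡⟨ ℕ.+-comm (m C suc d) _ ⟩
      D * ((D + m) C d) + (m C suc d)          ∎)) ⟩
    d ! * (D * ((D + m) C d))    ≡⟨ rearrange (d !) D _ ⟩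
    D * (((D + m) C d) * d !)    ≤⟨ ℕ.*-monoʳ-≤ D (C-upper (D + m) d) ⟩
    D * (D + m) ^ d            ∎
    where
    m = h + suc d
    rearrange : ∀ a b c → a * (b * c) ≡ b * (c * a)
    rearrange = ℕ-Solver.solve-∀

  F-lower : ∀ h → D * h ^ d ≤ d ! * F (D + h)
  F-lower h = begin
    D * h ^ d                     ≤⟨ ℕ.*-monoʳ-≤ D (C-lower h d) ⟩
    D * (((d + h) C d) * d !)       ≤⟨ ℕ.*-monoʳ-≤ D (ℕ.*-monoˡ-≤ (d !) (ℕ.≤-trans (C-mono-suc (d + h) d) (ℕ.≤-reflexive (cong (_C d) (ℕ.+-comm (suc d) h))))) ⟩
    D * ((m C d) * d !)             ≡⟨ rearrange D _ (d !) ⟩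
    d ! * (D * (m C d))             ≤⟨ ℕ.*-monoʳ-≤ (d !) (ℕ.+-cancelˡ-≤ (m C suc d) _ _ (begin
      (m C suc d) + D * (m C d)                ≤⟨ C-increment-lower D m d ⟩
      ((D + m) C suc d)                      ≡⟨ F≡ h ⟨
      F (D + h) + (m C suc d)                ≡⟨ ℕ.+-comm (F (D + h)) _ ⟩
      (m C suc d) + F (D + h)                ∎)) ⟩
    d ! * F (D + h)               ∎
    where
    m = h + suc d
    rearrange : ∀ a b c → a * (b * c) ≡ c * (a * b)
    rearrange = ℕ-Solver.solve-∀

  -- Here `l` stands for the number of points of the grid of mesh `1 / M` in an inner union of
  -- boxes; the hypothesis is the count at mesh `1 / (k M)`.
  leading-≤ : ∀ M {l} .{{_ : NonZero M}} → (∀ k → l * k ^ d ≤ F (D + (k * M + D))) → d ! * l ≤ D * M ^ d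
  leading-≤ M {l} bound = limit-≤-scaled c d λ m → begin
    d ! * l * (c * m) ^ d                          ≡⟨ ℕ.*-assoc (d !) l _ ⟩
    d ! * (l * (c * m) ^ d)                        ≤⟨ ℕ.*-monoʳ-≤ (d !) (bound (c * m)) ⟩
    d ! * F (D + (c * m * M + D))                  ≤⟨ F-upper (c * m * M + D) ⟩
    D * (D + (c * m * M + D + suc d)) ^ d          ≡⟨ cong (λ t → D * t ^ d) (regroup D d m M) ⟩
    D * (c * 1 + M * (c * m)) ^ d                  ≤⟨ ℕ.*-monoʳ-≤ D (ℕ.^-monoˡ-≤ d (ℕ.+-monoˡ-≤ _ (ℕ.≤-trans (ℕ.≤-reflexive (ℕ.*-identityʳ c)) (ℕ.m≤n*m c M)))) ⟩
    D * (M * c + M * (c * m)) ^ d                  ≡⟨ cong (λ t → D * t ^ d) (factor M c m) ⟩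
    D * (M * (c * suc m)) ^ d                      ≡⟨ cong (D *_) (^-distribʳ-* d M (c * suc m)) ⟩
    D * (M ^ d * (c * suc m) ^ d)                  ≡⟨ ℕ.*-assoc D (M ^ d) _ ⟨
    D * M ^ d * (c * suc m) ^ d                    ∎
    where
    -- The sum of the additive constants `D`, `D` and `suc d` that accompany `M * (c * m)`. It is at
    -- most `M * c`, hence absorbed by one step of `m`.
    c = suc (D + D + d)
    regroup : ∀ D d m M → D + (suc (D + D + d) * m * M + D + suc d) ≡ suc (D + D + d) * 1 + M * (suc (D + D + d) * m)
    regroup = ℕ-Solver.solve-∀
    factor : ∀ M c m → M * c + M * (c * m) ≡ M * (c * suc m)
    factor = ℕ-Solver.solve-∀

  leading-≥ : ∀ M {l} .{{_ : NonZero M}} → (∀ k .{{_ : NonZero k}} → F (k * M) ≤ l * k ^ d) → D * M ^ d ≤ d ! * l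
  -- The choice `k = D * suc m` is positive, and `h` satisfies `D + h = k * M`. Subtracting `D`,
  -- which is at most `M * D`, costs one step of `m`.
  leading-≥ M {l} bound = limit-≤-scaled D d λ m → let h = D * suc m * M ∸ D in begin
    D * M ^ d * (D * m) ^ d          ≡⟨ ℕ.*-assoc D (M ^ d) _ ⟩
    D * (M ^ d * (D * m) ^ d)        ≡⟨ cong (D *_) (^-distribʳ-* d M (D * m)) ⟨
    D * (M * (D * m)) ^ d            ≤⟨ ℕ.*-monoʳ-≤ D (ℕ.^-monoˡ-≤ d (ℕ.+-cancelˡ-≤ D _ _ (begin
      D + M * (D * m)                     ≤⟨ ℕ.+-monoˡ-≤ _ (ℕ.m≤n*m D M) ⟩
      M * D + M * (D * m)                 ≡⟨ factor M D m ⟩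
      D * suc m * M                       ≡⟨ ℕ.m+[n∸m]≡n (D≤ m) ⟨
      D + h                               ∎))) ⟩
    D * h ^ d                        ≤⟨ F-lower h ⟩
    d ! * F (D + h)                  ≡⟨ cong (λ t → d ! * F t) (ℕ.m+[n∸m]≡n (D≤ m)) ⟩
    d ! * F (D * suc m * M)          ≤⟨ ℕ.*-monoʳ-≤ (d !) (bound (D * suc m) {{ℕ.m*n≢0 D (suc m)}}) ⟩
    d ! * (l * (D * suc m) ^ d)      ≡⟨ ℕ.*-assoc (d !) l _ ⟨
    d ! * l * (D * suc m) ^ d        ∎
    where
    factor : ∀ M D m → M * D + M * (D * m) ≡ D * suc m * M
    factor = ℕ-Solver.solve-∀
    D≤ : ∀ m → D ≤ D * suc m * M
    D≤ m = ℕ.≤-trans (ℕ.m≤m*n D (suc m)) (ℕ.m≤m*n (D * suc m) M)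

-- Lattice points in boxes

toℚᵘ-fromℤ : ∀ i → toℚᵘ (fromℤ i) ≃ mkℚᵘ i 0
toℚᵘ-fromℤ i = ℚ.toℚᵘ-fromℚᵘ (mkℚᵘ i 0)

fromℤ-+ : ∀ i j → fromℤ (i ℤ.+ j) ≡ fromℤ i ℚ.+ fromℤ j
fromℤ-+ i j = ℚ.toℚᵘ-injective (begin
  toℚᵘ (fromℤ (i ℤ.+ j))                    ≈⟨ toℚᵘ-fromℤ (i ℤ.+ j) ⟩
  mkℚᵘ (i ℤ.+ j) 0                          ≈⟨ *≡* (lemma i j) ⟩
  mkℚᵘ i 0 ℚᵘ.+ mkℚᵘ j 0                    ≈⟨ ℚᵘ.+-cong (toℚᵘ-fromℤ i) (toℚᵘ-fromℤ j) ⟨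
  toℚᵘ (fromℤ i) ℚᵘ.+ toℚᵘ (fromℤ j)        ≈⟨ ℚ.toℚᵘ-homo-+ (fromℤ i) (fromℤ j) ⟨
  toℚᵘ (fromℤ i ℚ.+ fromℤ j)                ∎)
  where
  open ℚᵘ.≃-Reasoning
  lemma : ∀ i j → (i ℤ.+ j) ℤ.* 1ℤ ≡ (i ℤ.* 1ℤ ℤ.+ j ℤ.* 1ℤ) ℤ.* 1ℤ
  lemma = solve-∀

fromℤ-* : ∀ i j → fromℤ (i ℤ.* j) ≡ fromℤ i ℚ.* fromℤ j
fromℤ-* i j = ℚ.toℚᵘ-injective (begin
  toℚᵘ (fromℤ (i ℤ.* j))                    ≈⟨ toℚᵘ-fromℤ (i ℤ.* j) ⟩
  mkℚᵘ (i ℤ.* j) 0                          ≈⟨ ℚᵘ.*-cong (toℚᵘ-fromℤ i) (toℚᵘ-fromℤ j) ⟨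
  toℚᵘ (fromℤ i) ℚᵘ.* toℚᵘ (fromℤ j)        ≈⟨ ℚ.toℚᵘ-homo-* (fromℤ i) (fromℤ j) ⟨
  toℚᵘ (fromℤ i ℚ.* fromℤ j)                ∎)
  where open ℚᵘ.≃-Reasoning

fromℤ-neg : ∀ i → fromℤ (ℤ.- i) ≡ ℚ.- fromℤ i
fromℤ-neg i = ℚ.toℚᵘ-injective (begin
  toℚᵘ (fromℤ (ℤ.- i))      ≈⟨ toℚᵘ-fromℤ (ℤ.- i) ⟩
  ℚᵘ.- mkℚᵘ i 0             ≈⟨ ℚᵘ.-‿cong (toℚᵘ-fromℤ i) ⟨
  ℚᵘ.- toℚᵘ (fromℤ i)       ≈⟨ ℚ.toℚᵘ-homo‿- (fromℤ i) ⟨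
  toℚᵘ (ℚ.- fromℤ i)        ∎)
  where open ℚᵘ.≃-Reasoning

fromℤ-mono-≤ : ∀ {i j} → i ℤ.≤ j → fromℤ i ℚ.≤ fromℤ j
fromℤ-mono-≤ {i} {j} i≤j = ℚ.toℚᵘ-cancel-≤
  (ℚᵘ.≤-respˡ-≃ (ℚᵘ.≃-sym (toℚᵘ-fromℤ i)) (ℚᵘ.≤-respʳ-≃ (ℚᵘ.≃-sym (toℚᵘ-fromℤ j))
    (*≤* (ℤ.*-monoʳ-≤-nonNeg 1ℤ i≤j))))

fromℤ-mono-< : ∀ {i j} → i ℤ.< j → fromℤ i ℚ.< fromℤ j
fromℤ-mono-< {i} {j} i<j = ℚ.toℚᵘ-cancel-<
  (ℚᵘ.<-respˡ-≃ (ℚᵘ.≃-sym (toℚᵘ-fromℤ i)) (ℚᵘ.<-respʳ-≃ (ℚᵘ.≃-sym (toℚᵘ-fromℤ j))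
    (*<* (ℤ.*-monoʳ-<-pos 1ℤ i<j))))

fromℤ-cancel-≤ : ∀ {i j} → fromℤ i ℚ.≤ fromℤ j → i ℤ.≤ j
fromℤ-cancel-≤ p = ℤ.≮⇒≥ (λ j<i → ℚ.<-irrefl refl (ℚ.<-≤-trans (fromℤ-mono-< j<i) p))

fromℤ-cancel-< : ∀ {i j} → fromℤ i ℚ.< fromℤ j → i ℤ.< j
fromℤ-cancel-< p = ℤ.≰⇒> (λ j≤i → ℚ.<-irrefl refl (ℚ.<-≤-trans p (fromℤ-mono-≤ j≤i)))

fromℤ-injective : ∀ {i j} → fromℤ i ≡ fromℤ j → i ≡ j
fromℤ-injective eq = ℤ.≤-antisym (fromℤ-cancel-≤ (ℚ.≤-reflexive eq)) (fromℤ-cancel-≤ (ℚ.≤-reflexive (sym eq)))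

fromℕ : ℕ → ℚ
fromℕ k = fromℤ (+ k)

fromℕ-* : ∀ k l → fromℕ (k ℕ.* l) ≡ fromℕ k ℚ.* fromℕ l
fromℕ-* k l = trans (cong fromℤ (ℤ.pos-* k l)) (fromℤ-* (+ k) (+ l))

fromℕ-positive : ∀ N .{{_ : NonZero N}} → ℚ.Positive (fromℕ N)
fromℕ-positive (suc N) = ℚ.positive (fromℤ-mono-< {0ℤ} {+ suc N} (ℤ.+<+ (s≤s z≤n)))

*-cancelˡ-fromℕ : ∀ N .{{_ : NonZero N}} {p q} → fromℕ N ℚ.* p ≡ fromℕ N ℚ.* q → p ≡ q
*-cancelˡ-fromℕ N eq = ℚ.≤-antisym
  (ℚ.*-cancelˡ-≤-pos (fromℕ N) {{fromℕ-positive N}} (ℚ.≤-reflexive eq))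
  (ℚ.*-cancelˡ-≤-pos (fromℕ N) {{fromℕ-positive N}} (ℚ.≤-reflexive (sym eq)))

fromℕ-*-/ : ∀ N .{{_ : NonZero N}} i → fromℕ N ℚ.* (i ℚ./ N) ≡ fromℤ i
fromℕ-*-/ N@(suc N-1) i = ℚ.toℚᵘ-injective (begin
  toℚᵘ (fromℕ N ℚ.* (i ℚ./ N))            ≈⟨ ℚ.toℚᵘ-homo-* (fromℕ N) (i ℚ./ N) ⟩
  toℚᵘ (fromℕ N) ℚᵘ.* toℚᵘ (i ℚ./ N)      ≈⟨ ℚᵘ.*-cong (toℚᵘ-fromℤ (+ N)) (ℚ.toℚᵘ-fromℚᵘ (mkℚᵘ i N-1)) ⟩
  mkℚᵘ (+ N) 0 ℚᵘ.* mkℚᵘ i N-1            ≈⟨ *≡* (lemma (+ N) i) ⟩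
  mkℚᵘ i 0                                ≈⟨ toℚᵘ-fromℤ i ⟨
  toℚᵘ (fromℤ i)                          ∎)
  where
  open ℚᵘ.≃-Reasoning
  lemma : ∀ N i → (N ℤ.* i) ℤ.* 1ℤ ≡ i ℤ.* (1ℤ ℤ.* N)
  lemma = solve-∀

-- Clearing denominators

_÷_ : ℤ^ d → (N : ℕ) → .{{NonZero N}} → ℚ^ d
x ÷ N = map (ℚ._/ N) x

-- The equation `q = i / N` with the denominator multiplied out, which avoids reduced fractions. The
-- record keeps `q` and `i` recoverable by unification.
record Scales (N : ℕ) (q : ℚ) (i : ℤ) : Set where
  constructor scales
  field eq : fromℕ N ℚ.* q ≡ fromℤ i

/-scales : ∀ N .{{_ : NonZero N}} i → Scales N (i ℚ./ N) i
/-scales N i = scales (fromℕ-*-/ N i)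

Integral : ℕ → ℚ → Set
Integral N q = ∃[ i ] Scales N q i

Integral-* : ∀ k {N} q → Integral N q → Integral (k ℕ.* N) q
Integral-* k {N} q (i , scales eq) = + k ℤ.* i , scales (begin
  fromℕ (k ℕ.* N) ℚ.* q             ≡⟨ cong (ℚ._* q) (fromℕ-* k N) ⟩
  (fromℕ k ℚ.* fromℕ N) ℚ.* q       ≡⟨ ℚ.*-assoc (fromℕ k) (fromℕ N) q ⟩
  fromℕ k ℚ.* (fromℕ N ℚ.* q)       ≡⟨ cong (fromℕ k ℚ.*_) eq ⟩
  fromℕ k ℚ.* fromℤ i               ≡⟨ fromℤ-* (+ k) i ⟨
  fromℤ (+ k ℤ.* i)                 ∎)
  where open ≡-Reasoning

denominator : ∀ q → ∃[ N-1 ] Integral (suc N-1) q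
denominator q = ℚ.denominator-1 q , ℚ.↥ q ,
  subst (λ p → Scales (ℚ.↧ₙ q) p (ℚ.↥ q)) (ℚ.↥p/↧p≡p q) (/-scales (ℚ.↧ₙ q) (ℚ.↥ q))

-- The product of the individual denominators works because `P` passes to multiples. `P` is abstract
-- since weights, sides of a box and whole boxes all need a common denominator.
commonMultiple : {P : ℕ → X → Set} → (∀ k {N} x → P N x → P (k ℕ.* N) x) →
                 (∀ x → ∃[ N-1 ] P (suc N-1) x) → ∀ xs → ∃[ N-1 ] All.All (P (suc N-1)) xs
commonMultiple P-* P-∃ List.[] = 0 , []
commonMultiple {P = P} P-* P-∃ (x List.∷ xs) with P-∃ x | commonMultiple {P = P} P-* P-∃ xs
... | M-1 , Px | N-1 , Pxs = _ , subst (λ k → P k x) (ℕ.*-comm (suc N-1) (suc M-1)) (P-* (suc N-1) x Px)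
                               ∷ All.map (P-* (suc M-1) _) Pxs

commonMultipleᵛ : {P : ℕ → X → Set} → (∀ k {N} x → P N x → P (k ℕ.* N) x) →
                  (∀ x → ∃[ N-1 ] P (suc N-1) x) → (xs : Vec X n) → ∃[ N-1 ] VecAll.All (P (suc N-1)) xs
commonMultipleᵛ {P = P} P-* P-∃ xs with commonMultiple {P = P} P-* P-∃ (toList xs)
... | N-1 , Pxs = N-1 , VecAll.toList⁻ Pxs

IntegralBox : ℕ → Box d → Set
IntegralBox N = VecAll.All (λ I → Integral N (lo I) × Integral N (hi I))

IntegralBox-* : ∀ k {N} (B : Box d) → IntegralBox N B → IntegralBox (k ℕ.* N) B
IntegralBox-* k B = VecAll.map (λ (l , h) → Integral-* k _ l , Integral-* k _ h)

denominatorBox : (B : Box d) → ∃[ N-1 ] IntegralBox (suc N-1) B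
denominatorBox = commonMultipleᵛ {P = λ N I → Integral N (lo I) × Integral N (hi I)} (λ k I (l , h) → Integral-* k _ l , Integral-* k _ h) endpoints
  where
  endpoints : ∀ I → ∃[ N-1 ] (Integral (suc N-1) (lo I) × Integral (suc N-1) (hi I))
  endpoints I with denominator (lo I) | denominator (hi I)
  ... | a , p | b , q = _ , Integral-* (suc b) (lo I) p
    , subst (λ k → Integral k (hi I)) (ℕ.*-comm (suc a) (suc b)) (Integral-* (suc a) (hi I) q)

length-cartesianProductWith : ∀ (f : X → Y → Z) xs ys →
                              length (cartesianProductWith f xs ys) ≡ length xs ℕ.* length ys
length-cartesianProductWith f List.[]       ys = refl
length-cartesianProductWith f (x List.∷ xs) ys = trans (List.length-++ (List.map (f x) ys))
  (cong₂ ℕ._+_ (List.length-map (f x) ys) (length-cartesianProductWith f xs ys))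

range : ℤ → ℤ → List ℤ
range L H = List.map (λ k → L ℤ.+ + k) (upTo ℤ.∣ H ℤ.- L ∣)

∣∣-inverse : ∀ {i j} → i ℤ.≤ j → + ℤ.∣ j ℤ.- i ∣ ≡ j ℤ.- i
∣∣-inverse i≤j = ℤ.0≤i⇒+∣i∣≡i (ℤ.i≤j⇒0≤j-i i≤j)

range-unique : ∀ L H → Uniqueₗ (range L H)
range-unique L H = Unique.map⁺ (λ eq → ℤ.+-injective (∙-cancelˡ ℤ.+-0-abelianGroup L _ _ eq)) (Unique.upTo⁺ _)

∈-range⁺ : ∀ {L H i} → L ℤ.≤ i → i ℤ.< H → i ∈ range L H
∈-range⁺ {L} {H} {i} L≤i i<H = subst (_∈ range L H) (sym i≡) (∈-map⁺ _ (∈-upTo⁺ bound))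
  where
  lemma : ∀ L i → i ≡ L ℤ.+ (i ℤ.- L)
  lemma = solve-∀
  i≡ : i ≡ L ℤ.+ + ℤ.∣ i ℤ.- L ∣
  i≡ = trans (lemma L i) (cong (λ t → L ℤ.+ t) (sym (∣∣-inverse L≤i)))
  bound : ℤ.∣ i ℤ.- L ∣ ℕ.< ℤ.∣ H ℤ.- L ∣
  bound = ℤ.drop‿+<+ (subst₂ ℤ._<_ (sym (∣∣-inverse L≤i)) (sym (∣∣-inverse (ℤ.<⇒≤ (ℤ.≤-<-trans L≤i i<H))))
            (ℤ.+-monoˡ-< (ℤ.- L) i<H))

∈-range⁻ : ∀ {L H i} → L ℤ.≤ H → i ∈ range L H → L ℤ.≤ i × i ℤ.< H
∈-range⁻ {L} {H} L≤H i∈ with ∈-map⁻ (λ k → L ℤ.+ + k) i∈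
... | k , k∈ , refl = ℤ.i≤i+j L (+ k) , (begin-strict
  L ℤ.+ + k                   <⟨ ℤ.+-monoʳ-< L (ℤ.+<+ (∈-upTo⁻ k∈)) ⟩
  L ℤ.+ + ℤ.∣ H ℤ.- L ∣       ≡⟨ cong (λ t → L ℤ.+ t) (∣∣-inverse L≤H) ⟩
  L ℤ.+ (H ℤ.- L)             ≡⟨ lemma L H ⟨
  H                           ∎)
  where
  open ℤ.≤-Reasoning
  lemma : ∀ L i → i ≡ L ℤ.+ (i ℤ.- L)
  lemma = solve-∀

length-range : ∀ {L H} → L ℤ.≤ H → + length (range L H) ≡ H ℤ.- L
length-range {L} {H} L≤H = trans (cong (λ k → + k) (trans (List.length-map _ (upTo ℤ.∣ H ℤ.- L ∣)) (List.length-upTo _)))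
                                 (∣∣-inverse L≤H)

module Grid (N : ℕ) .{{_ : NonZero N}} where

  private instance
    N-positive : ℚ.Positive (fromℕ N)
    N-positive = fromℕ-positive N
    N-nonNegative : ℚ.NonNegative (fromℕ N)
    N-nonNegative = ℚ.pos⇒nonNeg (fromℕ N)

  scale-≤ : ∀ {p q i j} → Scales N p i → Scales N q j → p ℚ.≤ q → i ℤ.≤ j
  scale-≤ (scales e) (scales e′) p≤q = fromℤ-cancel-≤ (subst₂ ℚ._≤_ e e′ (ℚ.*-monoˡ-≤-nonNeg (fromℕ N) p≤q))

  unscale-≤ : ∀ {p q i j} → Scales N p i → Scales N q j → i ℤ.≤ j → p ℚ.≤ q
  unscale-≤ (scales e) (scales e′) i≤j = ℚ.*-cancelˡ-≤-pos (fromℕ N) (subst₂ ℚ._≤_ (sym e) (sym e′) (fromℤ-mono-≤ i≤j))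

  scale-< : ∀ {p q i j} → Scales N p i → Scales N q j → p ℚ.< q → i ℤ.< j
  scale-< (scales e) (scales e′) p<q = fromℤ-cancel-< (subst₂ ℚ._<_ e e′ (ℚ.*-monoʳ-<-pos (fromℕ N) p<q))

  unscale-< : ∀ {p q i j} → Scales N p i → Scales N q j → i ℤ.< j → p ℚ.< q
  unscale-< (scales e) (scales e′) i<j = ℚ.*-cancelˡ-<-nonNeg (fromℕ N) (subst₂ ℚ._<_ (sym e) (sym e′) (fromℤ-mono-< i<j))

  boxPoints : (B : Box d) → IntegralBox N B → List (ℤ^ d)
  boxPoints []      []                         = List.[ [] ]
  boxPoints (I ∷ B) (((L , _) , (H , _)) ∷ iB) = cartesianProductWith _∷_ (range L H) (boxPoints B iB)

  boxPoints-unique : (B : Box d) (iB : IntegralBox N B) → Uniqueₗ (boxPoints B iB)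
  boxPoints-unique []      []                         = [] ∷ []
  boxPoints-unique (I ∷ B) (((L , _) , (H , _)) ∷ iB) =
    Unique.cartesianProductWith⁺ _∷_ ∷-injective (range-unique L H) (boxPoints-unique B iB)

  ∈-boxPoints⁺ : (B : Box d) (iB : IntegralBox N B) {x : ℤ^ d} → ⟦ B ⟧ (x ÷ N) → x ∈ boxPoints B iB
  ∈-boxPoints⁺ []      []                           {[]}    [] = here refl
  ∈-boxPoints⁺ (I ∷ B) (((L , eL) , (H , eH)) ∷ iB) {i ∷ x} ((l , h) ∷ x∈) =
    ∈-cartesianProductWith⁺ _∷_ (∈-range⁺ {L} {H} (scale-≤ eL (/-scales N i) l) (scale-< (/-scales N i) eH h))
                                (∈-boxPoints⁺ B iB x∈)

  ∈-boxPoints⁻ : (B : Box d) (iB : IntegralBox N B) {x : ℤ^ d} → x ∈ boxPoints B iB → ⟦ B ⟧ (x ÷ N)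
  ∈-boxPoints⁻ []      []                           {[]} _ = []
  ∈-boxPoints⁻ (I ∷ B) (((L , eL) , (H , eH)) ∷ iB) x∈
    with ∈-cartesianProductWith⁻ _∷_ (range L H) (boxPoints B iB) x∈
  ... | i , x , i∈ , x∈′ , refl with ∈-range⁻ {L} {H} (scale-≤ eL eH (lo≤hi I)) i∈
  ...   | L≤i , i<H = (unscale-≤ eL (/-scales N i) L≤i , unscale-< (/-scales N i) eH i<H) ∷ ∈-boxPoints⁻ B iB x∈′

  -- Half-open sides make the count exact: a side from `L / N` to `H / N` contains `H - L` grid
  -- values, with no boundary correction.
  length-boxPoints : (B : Box d) (iB : IntegralBox N B) →
                     fromℕ (length (boxPoints B iB)) ≡ fromℕ (N ^ d) ℚ.* boxVolume B
  length-boxPoints []      [] = refl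
  length-boxPoints {suc d} (I ∷ B) (((L , eL) , (H , eH)) ∷ iB) = begin
    fromℕ (length (cartesianProductWith _∷_ (range L H) (boxPoints B iB)))
      ≡⟨ cong fromℕ (length-cartesianProductWith _∷_ (range L H) (boxPoints B iB)) ⟩
    fromℕ (length (range L H) ℕ.* length (boxPoints B iB))
      ≡⟨ fromℕ-* (length (range L H)) _ ⟩
    fromℕ (length (range L H)) ℚ.* fromℕ (length (boxPoints B iB))
      ≡⟨ cong₂ ℚ._*_ (cong fromℤ (length-range {L} {H} (scale-≤ eL eH (lo≤hi I)))) (length-boxPoints B iB) ⟩
    fromℤ (H ℤ.- L) ℚ.* (fromℕ (N ^ d) ℚ.* boxVolume B)
      ≡⟨ cong (ℚ._* (fromℕ (N ^ d) ℚ.* boxVolume B)) side ⟩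
    (fromℕ N ℚ.* hi I ℚ.- fromℕ N ℚ.* lo I) ℚ.* (fromℕ (N ^ d) ℚ.* boxVolume B)
      ≡⟨ regroup (fromℕ N) (hi I) (lo I) (fromℕ (N ^ d)) (boxVolume B) ⟩
    (fromℕ N ℚ.* fromℕ (N ^ d)) ℚ.* ((hi I ℚ.- lo I) ℚ.* boxVolume B)
      ≡⟨ cong (ℚ._* ((hi I ℚ.- lo I) ℚ.* boxVolume B)) (fromℕ-* N (N ^ d)) ⟨
    fromℕ (N ^ suc d) ℚ.* ((hi I ℚ.- lo I) ℚ.* boxVolume B) ∎
    where
    open ≡-Reasoning
    side : fromℤ (H ℤ.- L) ≡ fromℕ N ℚ.* hi I ℚ.- fromℕ N ℚ.* lo I
    side = trans (fromℤ-+ H (ℤ.- L)) (cong₂ ℚ._+_ (sym (Scales.eq eH)) (trans (fromℤ-neg L) (cong ℚ.-_ (sym (Scales.eq eL)))))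
    regroup : ∀ n h l m v → (n ℚ.* h ℚ.- n ℚ.* l) ℚ.* (m ℚ.* v) ≡ (n ℚ.* m) ℚ.* ((h ℚ.- l) ℚ.* v)
    regroup = solve 5 (λ n h l m v → (n :* h :- n :* l) :* (m :* v) := (n :* m) :* ((h :- l) :* v)) refl
      where open +-*-Solver

  -- Overlaps are counted with multiplicity, as in `totalVolume`, so that one counting formula
  -- serves both the disjoint unions and the covers.
  points : (Bs : List (Box d)) → All.All (IntegralBox N) Bs → List (ℤ^ d)
  points List.[]       []         = List.[]
  points (B List.∷ Bs) (iB ∷ iBs) = boxPoints B iB List.++ points Bs iBs

  ∈-points⁺ : (Bs : List (Box d)) (iBs : All.All (IntegralBox N) Bs) {x : ℤ^ d} → ⋃ Bs (x ÷ N) → x ∈ points Bs iBs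
  ∈-points⁺ (B List.∷ Bs) (iB ∷ iBs) (here p)  = ∈-++⁺ˡ (∈-boxPoints⁺ B iB p)
  ∈-points⁺ (B List.∷ Bs) (iB ∷ iBs) (there p) = ∈-++⁺ʳ (boxPoints B iB) (∈-points⁺ Bs iBs p)

  ∈-points⁻ : (Bs : List (Box d)) (iBs : All.All (IntegralBox N) Bs) {x : ℤ^ d} → x ∈ points Bs iBs → ⋃ Bs (x ÷ N)
  ∈-points⁻ (B List.∷ Bs) (iB ∷ iBs) x∈ with ∈-++⁻ (boxPoints B iB) x∈
  ... | inj₁ p = here (∈-boxPoints⁻ B iB p)
  ... | inj₂ p = there (∈-points⁻ Bs iBs p)

  points-unique : (Bs : List (Box d)) (iBs : All.All (IntegralBox N) Bs) →
                  AllPairs (λ B B′ → ⟦ B ⟧ ⊥ ⟦ B′ ⟧) Bs → Uniqueₗ (points Bs iBs)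
  points-unique List.[]       []         []         = []
  points-unique (B List.∷ Bs) (iB ∷ iBs) (B⊥ ∷ Bs⊥) =
    Unique.++⁺ (boxPoints-unique B iB) (points-unique Bs iBs Bs⊥) (λ (p , q) → meet B⊥ (∈-boxPoints⁻ B iB p) (∈-points⁻ Bs iBs q))
    where
    meet : ∀ {Bs : List (Box _)} {y} → All.All (λ B′ → ⟦ B ⟧ ⊥ ⟦ B′ ⟧) Bs → ⟦ B ⟧ y → ¬ ⋃ Bs y
    meet (B⊥B′ ∷ _) p (here q)  = B⊥B′ (p , q)
    meet (_ ∷ B⊥)   p (there q) = meet B⊥ p q

  length-points : (Bs : List (Box d)) (iBs : All.All (IntegralBox N) Bs) →
                  fromℕ (length (points Bs iBs)) ≡ fromℕ (N ^ d) ℚ.* totalVolume Bs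
  length-points {d} List.[] [] = sym (ℚ.*-zeroʳ (fromℕ (N ^ d)))
  length-points {d} (B List.∷ Bs) (iB ∷ iBs) = begin
    fromℕ (length (boxPoints B iB List.++ points Bs iBs))
      ≡⟨ cong fromℕ (List.length-++ (boxPoints B iB)) ⟩
    fromℤ (+ length (boxPoints B iB) ℤ.+ + length (points Bs iBs))
      ≡⟨ fromℤ-+ (+ length (boxPoints B iB)) (+ length (points Bs iBs)) ⟩
    fromℕ (length (boxPoints B iB)) ℚ.+ fromℕ (length (points Bs iBs))
      ≡⟨ cong₂ ℚ._+_ (length-boxPoints B iB) (length-points Bs iBs) ⟩
    fromℕ (N ^ d) ℚ.* boxVolume B ℚ.+ fromℕ (N ^ d) ℚ.* totalVolume Bs
      ≡⟨ ℚ.*-distribˡ-+ (fromℕ (N ^ d)) _ _ ⟨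
    fromℕ (N ^ d) ℚ.* (boxVolume B ℚ.+ totalVolume Bs) ∎
    where open ≡-Reasoning

-- Lattice points in the convex hull

map-fromℤ-+ : (x y : ℤ^ d) → map fromℤ (x +ᶻ y) ≡ map fromℤ x +ᵠ map fromℤ y
map-fromℤ-+ []      []      = refl
map-fromℤ-+ (a ∷ x) (b ∷ y) = cong₂ _∷_ (fromℤ-+ a b) (map-fromℤ-+ x y)

map-fromℤ-· : ∀ k (x : ℤ^ d) → map fromℤ (k ·ᶻ x) ≡ fromℤ k ·ᵠ map fromℤ x
map-fromℤ-· k []      = refl
map-fromℤ-· k (a ∷ x) = cong₂ _∷_ (fromℤ-* k a) (map-fromℤ-· k x)

map-fromℤ-injective : {x y : ℤ^ d} → map fromℤ x ≡ map fromℤ y → x ≡ y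
map-fromℤ-injective {x = []}    {[]}    _  = refl
map-fromℤ-injective {x = _ ∷ _} {_ ∷ _} eq =
  cong₂ _∷_ (fromℤ-injective (∷-injectiveˡ eq)) (map-fromℤ-injective (∷-injectiveʳ eq))

·ᵠ-zeroʳ : ∀ d q → q ·ᵠ 0ᵠ {d} ≡ 0ᵠ
·ᵠ-zeroʳ zero    q = refl
·ᵠ-zeroʳ (suc d) q = cong₂ _∷_ (ℚ.*-zeroʳ q) (·ᵠ-zeroʳ d q)

·ᵠ-distribˡ : ∀ q (x y : ℚ^ d) → q ·ᵠ (x +ᵠ y) ≡ q ·ᵠ x +ᵠ q ·ᵠ y
·ᵠ-distribˡ q []      []      = refl
·ᵠ-distribˡ q (a ∷ x) (b ∷ y) = cong₂ _∷_ (ℚ.*-distribˡ-+ q a b) (·ᵠ-distribˡ q x y)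

·ᵠ-assoc : ∀ p q (x : ℚ^ d) → p ·ᵠ (q ·ᵠ x) ≡ (p ℚ.* q) ·ᵠ x
·ᵠ-assoc p q []      = refl
·ᵠ-assoc p q (a ∷ x) = cong₂ _∷_ (sym (ℚ.*-assoc p q a)) (·ᵠ-assoc p q x)

·ᵠ-cancelˡ : ∀ N .{{_ : NonZero N}} {x y : ℚ^ d} → fromℕ N ·ᵠ x ≡ fromℕ N ·ᵠ y → x ≡ y
·ᵠ-cancelˡ N {[]}    {[]}    _  = refl
·ᵠ-cancelˡ N {_ ∷ _} {_ ∷ _} eq = cong₂ _∷_ (*-cancelˡ-fromℕ N (∷-injectiveˡ eq)) (·ᵠ-cancelˡ N (∷-injectiveʳ eq))

·ᵠ-÷ : ∀ N .{{_ : NonZero N}} (x : ℤ^ d) → fromℕ N ·ᵠ (x ÷ N) ≡ map fromℤ x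
·ᵠ-÷ N []      = refl
·ᵠ-÷ N (a ∷ x) = cong₂ _∷_ (fromℕ-*-/ N a) (·ᵠ-÷ N x)

÷-scales : ∀ N .{{_ : NonZero N}} (x : ℤ^ d) → Pointwise (Scales N) (x ÷ N) x
÷-scales N []      = []
÷-scales N (a ∷ x) = /-scales N a ∷ ÷-scales N x

combᵠ : Vec (ℤ^ d) n → ℚ^ n → ℚ^ d
combᵠ A w = foldr′ _+ᵠ_ 0ᵠ (zipWith _·ᵠ_ w (map (map fromℤ) A))

scale-combᵠ : ∀ {N} (A : Vec (ℤ^ d) n) {w c} → Pointwise (Scales N) w c → fromℕ N ·ᵠ combᵠ A w ≡ map fromℤ (comb A c)
scale-combᵠ {d} {N = N} [] [] = trans (·ᵠ-zeroʳ d (fromℕ N)) (sym (map-fromℤ-0 d))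
  where
  map-fromℤ-0 : ∀ d → map fromℤ (0ᶻ {d}) ≡ 0ᵠ
  map-fromℤ-0 zero    = refl
  map-fromℤ-0 (suc d) = cong (0ℚ ∷_) (map-fromℤ-0 d)
scale-combᵠ {N = N} (a ∷ A) {q ∷ w} {k ∷ c} (scales e ∷ s) = begin
  fromℕ N ·ᵠ (q ·ᵠ map fromℤ a +ᵠ combᵠ A w)
    ≡⟨ ·ᵠ-distribˡ (fromℕ N) _ _ ⟩
  fromℕ N ·ᵠ (q ·ᵠ map fromℤ a) +ᵠ fromℕ N ·ᵠ combᵠ A w
    ≡⟨ cong₂ _+ᵠ_ (·ᵠ-assoc (fromℕ N) q (map fromℤ a)) (scale-combᵠ A s) ⟩
  (fromℕ N ℚ.* q) ·ᵠ map fromℤ a +ᵠ map fromℤ (comb A c)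
    ≡⟨ cong (λ t → t ·ᵠ map fromℤ a +ᵠ map fromℤ (comb A c)) e ⟩
  fromℤ k ·ᵠ map fromℤ a +ᵠ map fromℤ (comb A c)
    ≡⟨ cong (_+ᵠ map fromℤ (comb A c)) (map-fromℤ-· k a) ⟨
  map fromℤ (k ·ᶻ a) +ᵠ map fromℤ (comb A c)
    ≡⟨ map-fromℤ-+ (k ·ᶻ a) (comb A c) ⟨
  map fromℤ (k ·ᶻ a +ᶻ comb A c) ∎
  where open ≡-Reasoning

scale-sum : ∀ {N} {w : ℚ^ n} {c : ℤ^ n} → Pointwise (Scales N) w c →
            fromℕ N ℚ.* foldr′ ℚ._+_ 0ℚ w ≡ fromℤ (foldr′ ℤ._+_ 0ℤ c)
scale-sum {N = N} [] = ℚ.*-zeroʳ (fromℕ N)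
scale-sum {N = N} {q ∷ w} {k ∷ c} (scales e ∷ s) = begin
  fromℕ N ℚ.* (q ℚ.+ foldr′ ℚ._+_ 0ℚ w)                    ≡⟨ ℚ.*-distribˡ-+ (fromℕ N) q _ ⟩
  fromℕ N ℚ.* q ℚ.+ fromℕ N ℚ.* foldr′ ℚ._+_ 0ℚ w          ≡⟨ cong₂ ℚ._+_ e (scale-sum s) ⟩
  fromℤ k ℚ.+ fromℤ (foldr′ ℤ._+_ 0ℤ c)                    ≡⟨ fromℤ-+ k (foldr′ ℤ._+_ 0ℤ c) ⟨
  fromℤ (k ℤ.+ foldr′ ℤ._+_ 0ℤ c)                          ∎
  where open ≡-Reasoning

0-scales : ∀ N → Scales N 0ℚ 0ℤ
0-scales N = scales (ℚ.*-zeroʳ (fromℕ N))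

-- Coefficients `c` of sum `N` become the weights `c / N`; both equations are checked after
-- multiplication by `N`.
∈-sumset⇒∈-Δ : ∀ N .{{_ : NonZero N}} (A : Vec (ℤ^ d) n) {x} → x ∈ sumset N A → Δ A (x ÷ N)
∈-sumset⇒∈-Δ N A x∈ with ∈-sumset⁻ N x∈
... | c , sum≡N , refl = ι c ÷ N , nonNegative c , weights , point
  where
  open ≡-Reasoning

  nonNegative : ∀ {n} (c : Vec ℕ n) → VecAll.All (0ℚ ℚ.≤_) (ι c ÷ N)
  nonNegative []      = []
  nonNegative (k ∷ c) = Grid.unscale-≤ N (0-scales N) (/-scales N (+ k)) (ℤ.+≤+ z≤n) ∷ nonNegative c

  weights : foldr′ ℚ._+_ 0ℚ (ι c ÷ N) ≡ 1ℚ
  weights = *-cancelˡ-fromℕ N (begin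
    fromℕ N ℚ.* foldr′ ℚ._+_ 0ℚ (ι c ÷ N)   ≡⟨ scale-sum (÷-scales N (ι c)) ⟩
    fromℤ (foldr′ ℤ._+_ 0ℤ (ι c))           ≡⟨ cong fromℤ (Σ-ι c) ⟩
    fromℕ (sum c)                           ≡⟨ cong fromℕ sum≡N ⟩
    fromℕ N                                 ≡⟨ ℚ.*-identityʳ (fromℕ N) ⟨
    fromℕ N ℚ.* 1ℚ                          ∎)

  point : comb A (ι c) ÷ N ≡ combᵠ A (ι c ÷ N)
  point = ·ᵠ-cancelˡ N (trans (·ᵠ-÷ N (comb A (ι c))) (sym (scale-combᵠ A (÷-scales N (ι c)))))

numerators : ∀ p .{{_ : NonZero p}} {w : ℚ^ n} → VecAll.All (Integral p) w → VecAll.All (0ℚ ℚ.≤_) w →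
             ∃ λ (c : Vec ℕ n) → Pointwise (Scales p) w (ι c)
numerators p []             []         = [] , []
numerators p ((i , s) ∷ is) (w≥0 ∷ ws) with Grid.scale-≤ p (0-scales p) s w≥0 | numerators p is ws
... | ℤ.+≤+ {n = k} _ | c , ss = k ∷ c , s ∷ ss

-- With a common denominator `p` the weights are `c / p`. Multiplying the convex combination for
-- `x / N` by `p N` leaves an equation between lattice points.
∈-Δ⇒comb : ∀ N .{{_ : NonZero N}} (A : Vec (ℤ^ d) n) x → Δ A (x ÷ N) →
           ∃[ p-1 ] ∃[ c ] sum c ≡ suc p-1 × + suc p-1 ·ᶻ x ≡ + N ·ᶻ comb A (ι c)
∈-Δ⇒comb N A x (w , w≥0 , Σw≡1 , x≡) with commonMultipleᵛ {P = Integral} (λ k → Integral-* k) denominator w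
... | p-1 , integral with numerators (suc p-1) integral w≥0
...   | c , s = p-1 , c , ℤ.+-injective (trans (sym (Σ-ι c)) (fromℤ-injective (sym (begin
    fromℕ p                             ≡⟨ ℚ.*-identityʳ (fromℕ p) ⟨
    fromℕ p ℚ.* 1ℚ                      ≡⟨ cong (fromℕ p ℚ.*_) Σw≡1 ⟨
    fromℕ p ℚ.* foldr′ ℚ._+_ 0ℚ w       ≡⟨ scale-sum s ⟩
    fromℤ (foldr′ ℤ._+_ 0ℤ (ι c))       ∎)))) , map-fromℤ-injective (begin
    map fromℤ (+ p ·ᶻ x)                    ≡⟨ map-fromℤ-· (+ p) x ⟩
    fromℕ p ·ᵠ map fromℤ x                  ≡⟨ cong (fromℕ p ·ᵠ_) (·ᵠ-÷ N x) ⟨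
    fromℕ p ·ᵠ (fromℕ N ·ᵠ (x ÷ N))         ≡⟨ ·ᵠ-assoc (fromℕ p) (fromℕ N) _ ⟩
    (fromℕ p ℚ.* fromℕ N) ·ᵠ (x ÷ N)        ≡⟨ cong (_·ᵠ (x ÷ N)) (ℚ.*-comm (fromℕ p) (fromℕ N)) ⟩
    (fromℕ N ℚ.* fromℕ p) ·ᵠ (x ÷ N)        ≡⟨ ·ᵠ-assoc (fromℕ N) (fromℕ p) _ ⟨
    fromℕ N ·ᵠ (fromℕ p ·ᵠ (x ÷ N))         ≡⟨ cong (λ y → fromℕ N ·ᵠ (fromℕ p ·ᵠ y)) x≡ ⟩
    fromℕ N ·ᵠ (fromℕ p ·ᵠ combᵠ A w)       ≡⟨ cong (fromℕ N ·ᵠ_) (scale-combᵠ A s) ⟩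
    fromℕ N ·ᵠ map fromℤ (comb A (ι c))     ≡⟨ map-fromℤ-· (+ N) (comb A (ι c)) ⟨
    map fromℤ (+ N ·ᶻ comb A (ι c))         ∎)
  where
  open ≡-Reasoning
  p : ℕ
  p = suc p-1

nonNegative-quotient : ∀ p-1 {z m} → + suc p-1 ℤ.* z ≡ + m → ∃[ k ] z ≡ + k
nonNegative-quotient p-1 {+ k}    _ = k , refl
nonNegative-quotient p-1 {z = -[1+ k ]} ()

-- If m - p y = s l with s = ρ + q p, then p (y + q l) = m - ρ l, which is at least -p |l|.
round : ∀ p-1 m y l s → + m ℤ.- + suc p-1 ℤ.* y ≡ s ℤ.* l →
        ∃[ k ] y ℤ.+ (s ℤ./ + suc p-1) ℤ.* l ℤ.+ + (posPart l + negPart l) ≡ + k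
round p-1 m y l s e = nonNegative-quotient p-1 (trans (isolate (+ m) (+ p) y s l q (+ (posPart l + negPart l)) e) (proj₂ (bound l)))
  where
  p = suc p-1
  q = s ℤ./ + p
  ρ = s ℤ.% + p
  r = p ∸ ρ

  p≡ : + p ≡ + ρ ℤ.+ + r
  p≡ = cong (λ k → + k) (sym (ℕ.m+[n∸m]≡n (ℕ.<⇒≤ (ℤ.n%d<d s (+ p)))))

  isolate : ∀ m p y s l q t → m ℤ.- p ℤ.* y ≡ s ℤ.* l →
            p ℤ.* (y ℤ.+ q ℤ.* l ℤ.+ t) ≡ m ℤ.- s ℤ.* l ℤ.+ p ℤ.* (q ℤ.* l ℤ.+ t)
  isolate m p y s l q t e = trans (lemma m p y q l t) (cong (λ v → m ℤ.- v ℤ.+ p ℤ.* (q ℤ.* l ℤ.+ t)) e)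
    where
    lemma : ∀ m p y q l t → p ℤ.* (y ℤ.+ q ℤ.* l ℤ.+ t) ≡ m ℤ.- (m ℤ.- p ℤ.* y) ℤ.+ p ℤ.* (q ℤ.* l ℤ.+ t)
    lemma = solve-∀

  -- What remains is `m + (p - ρ) a` for `l = a ≥ 0`, nonnegative because `ρ < p`, and
  -- `m + (ρ + p) b` for `l = - b < 0`.
  bound : ∀ l → ∃[ k ] + m ℤ.- s ℤ.* l ℤ.+ + p ℤ.* (q ℤ.* l ℤ.+ + (posPart l + negPart l)) ≡ + k
  bound (+ a) = m + r * a , (begin
    + m ℤ.- s ℤ.* + a ℤ.+ + p ℤ.* (q ℤ.* + a ℤ.+ + (a + 0))
      ≡⟨ cong₂ (λ u v → + m ℤ.- u ℤ.* + a ℤ.+ + p ℤ.* (q ℤ.* + a ℤ.+ + v)) (ℤ.a≡a%n+[a/n]*n s (+ p)) (ℕ.+-identityʳ a) ⟩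
    + m ℤ.- (+ ρ ℤ.+ q ℤ.* + p) ℤ.* + a ℤ.+ + p ℤ.* (q ℤ.* + a ℤ.+ + a)
      ≡⟨ cong (λ u → + m ℤ.- (+ ρ ℤ.+ q ℤ.* u) ℤ.* + a ℤ.+ u ℤ.* (q ℤ.* + a ℤ.+ + a)) p≡ ⟩
    + m ℤ.- (+ ρ ℤ.+ q ℤ.* (+ ρ ℤ.+ + r)) ℤ.* + a ℤ.+ (+ ρ ℤ.+ + r) ℤ.* (q ℤ.* + a ℤ.+ + a)
      ≡⟨ lemma (+ m) (+ ρ) (+ r) q (+ a) ⟩
    + m ℤ.+ + r ℤ.* + a
      ≡⟨ cong (λ t → + m ℤ.+ t) (ℤ.pos-* r a) ⟨
    + (m + r * a) ∎)
    where
    open ≡-Reasoning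
    lemma : ∀ m ρ r q a → m ℤ.- (ρ ℤ.+ q ℤ.* (ρ ℤ.+ r)) ℤ.* a ℤ.+ (ρ ℤ.+ r) ℤ.* (q ℤ.* a ℤ.+ a) ≡ m ℤ.+ r ℤ.* a
    lemma = solve-∀
  bound -[1+ b ] = m + (ρ + p) * suc b , (begin
    + m ℤ.- s ℤ.* ℤ.- (+ suc b) ℤ.+ + p ℤ.* (q ℤ.* ℤ.- (+ suc b) ℤ.+ + suc b)
      ≡⟨ cong (λ u → + m ℤ.- u ℤ.* ℤ.- (+ suc b) ℤ.+ + p ℤ.* (q ℤ.* ℤ.- (+ suc b) ℤ.+ + suc b)) (ℤ.a≡a%n+[a/n]*n s (+ p)) ⟩
    + m ℤ.- (+ ρ ℤ.+ q ℤ.* + p) ℤ.* ℤ.- (+ suc b) ℤ.+ + p ℤ.* (q ℤ.* ℤ.- (+ suc b) ℤ.+ + suc b)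
      ≡⟨ lemma (+ m) (+ ρ) (+ p) q (+ suc b) ⟩
    + m ℤ.+ (+ ρ ℤ.+ + p) ℤ.* + suc b
      ≡⟨ cong (λ t → + m ℤ.+ t) (ℤ.pos-* (ρ + p) (suc b)) ⟨
    + (m + (ρ + p) * suc b) ∎)
    where
    open ≡-Reasoning
    lemma : ∀ m ρ p q b → m ℤ.- (ρ ℤ.+ q ℤ.* p) ℤ.* ℤ.- b ℤ.+ p ℤ.* (q ℤ.* ℤ.- b ℤ.+ b) ≡ m ℤ.+ (ρ ℤ.+ p) ℤ.* b
    lemma = solve-∀

-- All coordinates are moved by the same multiple of `ℓ`, so the image under `comb⁺` is kept when
-- `ℓ` is a relation. The correction is the vector of absolute values of `ℓ`, the same for every `m`
-- and `y`.
roundᵛ : ∀ p-1 (m : Vec ℕ n) (y ℓ : ℤ^ n) s → ι m -ᶻ + suc p-1 ·ᶻ y ≡ s ·ᶻ ℓ →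
         ∃[ k ] y +ᶻ (s ℤ./ + suc p-1) ·ᶻ ℓ +ᶻ ι (map posPart ℓ +ⁿ map negPart ℓ) ≡ ι k
roundᵛ p-1 []      []      []      s _ = [] , refl
roundᵛ p-1 (m ∷ ms) (y ∷ ys) (l ∷ ℓ) s e
  with round p-1 m y l s (∷-injectiveˡ e) | roundᵛ p-1 ms ys ℓ s (∷-injectiveʳ e)
... | k , eq | ks , eqs = k ∷ ks , cong₂ _∷_ eq eqs

module Dilation
  (A : Vec (ℤ^ d) n) (ℓ : ℤ^ n) (ℓ≢0 : ℓ ≢ 0ᶻ) (ℓ∈ker : comb⁺ A ℓ ≡ 0ᶻ)
  (kernel : ∀ x → comb⁺ A x ≡ 0ᶻ → ∃[ t ] x ≡ t ·ᶻ ℓ)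
  (surjective : ∀ y → ∃[ c ] comb⁺ A c ≡ y)
  where

  open Relation A ℓ ℓ≢0 ℓ∈ker kernel

  -- The price of rounding: the point represented by the absolute values of the entries of `ℓ`, a
  -- sum of `2 D` elements of `A`.
  shift : ℤ^ d
  shift = comb A (ι (P +ⁿ Q))

  -- In homogeneous coordinates both `N c` and `p y` represent `p (N , x)`.
  difference∈ker : ∀ N p {x y c} → sum c ≡ p → + p ·ᶻ x ≡ + N ·ᶻ comb A (ι c) → comb⁺ A y ≡ + N ∷ x →
                   comb⁺ A (ι (map (N *_) c) -ᶻ + p ·ᶻ y) ≡ 0ᶻ
  difference∈ker N p {x} {y} {c} sum-c px≡ y≡ = begin
    comb⁺ A (ι (map (N *_) c) -ᶻ + p ·ᶻ y)                ≡⟨ -ᶻ-homo (comb⁺-linear A) (ι (map (N *_) c)) (+ p ·ᶻ y) ⟩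
    comb⁺ A (ι (map (N *_) c)) -ᶻ comb⁺ A (+ p ·ᶻ y)      ≡⟨ cong₂ _-ᶻ_ left right ⟩
    (+ N ·ᶻ comb⁺ A (ι c)) -ᶻ (+ N ·ᶻ comb⁺ A (ι c))      ≡⟨ x-x≡0 (+ N ·ᶻ comb⁺ A (ι c)) ⟩
    0ᶻ                                                    ∎
    where
    open ≡-Reasoning

    ι-* : ∀ {n} (c : Vec ℕ n) → ι (map (N *_) c) ≡ + N ·ᶻ ι c
    ι-* []      = refl
    ι-* (k ∷ c) = cong₂ _∷_ (ℤ.pos-* N k) (ι-* c)

    left : comb⁺ A (ι (map (N *_) c)) ≡ + N ·ᶻ comb⁺ A (ι c)
    left = trans (cong (comb⁺ A) (ι-* c)) (Linear.·-homo (comb⁺-linear A) (+ N) (ι c))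

    right : comb⁺ A (+ p ·ᶻ y) ≡ + N ·ᶻ comb⁺ A (ι c)
    right = begin
      comb⁺ A (+ p ·ᶻ y)       ≡⟨ Linear.·-homo (comb⁺-linear A) (+ p) y ⟩
      + p ·ᶻ comb⁺ A y         ≡⟨ cong (+ p ·ᶻ_) y≡ ⟩
      + p ℤ.* + N ∷ + p ·ᶻ x   ≡⟨ cong₂ _∷_ (ℤ.*-comm (+ p) (+ N)) px≡ ⟩
      + N ℤ.* + p ∷ + N ·ᶻ comb A (ι c)
        ≡⟨ cong (λ t → + N ℤ.* t ∷ + N ·ᶻ comb A (ι c)) (trans (cong (λ k → + k) (sym sum-c)) (sym (Σ-ι c))) ⟩
      + N ·ᶻ comb⁺ A (ι c)     ∎

  -- The relation `ℓ` does not affect the image, and `P +ⁿ Q` adds `2 D` summands. Their number is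
  -- written `D + (N + D)` to match the argument `D + h` in `Growth`.
  ∈-sumset-shift : ∀ N {x y q k} → comb⁺ A y ≡ + N ∷ x → y +ᶻ q ·ᶻ ℓ +ᶻ ι (P +ⁿ Q) ≡ ι k →
                   (x +ᶻ shift) ∈ sumset (D + (N + D)) A
  ∈-sumset-shift N {x} {y} {q} {k} y≡ z≡ = subst₂ (λ x h → x ∈ sumset h A) (∷-injectiveʳ total) sum-k (∈-sumset⁺ A k)
    where
    open ≡-Reasoning

    total : comb⁺ A (ι k) ≡ (+ N ∷ x) +ᶻ comb⁺ A (ι (P +ⁿ Q))
    total = begin
      comb⁺ A (ι k)
        ≡⟨ cong (comb⁺ A) z≡ ⟨
      comb⁺ A (y +ᶻ q ·ᶻ ℓ +ᶻ ι (P +ⁿ Q))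
        ≡⟨ Linear.+-homo (comb⁺-linear A) (y +ᶻ q ·ᶻ ℓ) (ι (P +ⁿ Q)) ⟩
      comb⁺ A (y +ᶻ q ·ᶻ ℓ) +ᶻ comb⁺ A (ι (P +ⁿ Q))
        ≡⟨ cong (_+ᶻ comb⁺ A (ι (P +ⁿ Q))) (Linear.+-homo (comb⁺-linear A) y (q ·ᶻ ℓ)) ⟩
      comb⁺ A y +ᶻ comb⁺ A (q ·ᶻ ℓ) +ᶻ comb⁺ A (ι (P +ⁿ Q))
        ≡⟨ cong (λ v → comb⁺ A y +ᶻ v +ᶻ comb⁺ A (ι (P +ⁿ Q))) (Linear.·-homo (comb⁺-linear A) q ℓ) ⟩
      comb⁺ A y +ᶻ q ·ᶻ comb⁺ A ℓ +ᶻ comb⁺ A (ι (P +ⁿ Q))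
        ≡⟨ cong₂ (λ u v → u +ᶻ q ·ᶻ v +ᶻ comb⁺ A (ι (P +ⁿ Q))) y≡ ℓ∈ker ⟩
      (+ N ∷ x) +ᶻ q ·ᶻ 0ᶻ +ᶻ comb⁺ A (ι (P +ⁿ Q))
        ≡⟨ cong (λ v → (+ N ∷ x) +ᶻ v +ᶻ comb⁺ A (ι (P +ⁿ Q))) (·ᶻ-zeroʳ (suc d) q) ⟩
      (+ N ∷ x) +ᶻ 0ᶻ +ᶻ comb⁺ A (ι (P +ⁿ Q))
        ≡⟨ cong (_+ᶻ comb⁺ A (ι (P +ⁿ Q))) (+ᶻ-identityʳ (+ N ∷ x)) ⟩
      (+ N ∷ x) +ᶻ comb⁺ A (ι (P +ⁿ Q)) ∎

    sum-k : sum k ≡ D + (N + D)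
    sum-k = ℤ.+-injective (begin
      + sum k                                      ≡⟨ Σ-ι k ⟨
      foldr′ ℤ._+_ 0ℤ (ι k)                        ≡⟨ ∷-injectiveˡ total ⟩
      + N ℤ.+ foldr′ ℤ._+_ 0ℤ (ι (P +ⁿ Q))         ≡⟨ cong (λ t → + N ℤ.+ t) (Σ-ι (P +ⁿ Q)) ⟩
      + (N + sum (P +ⁿ Q))                         ≡⟨ cong (λ t → + (N + t)) (trans (sum-+ⁿ P Q) (cong (λ t → D + t) sum-Q)) ⟩
      + (N + (D + D))                              ≡⟨ cong (λ k → + k) (x∙yz≈y∙xz ℕ.+-commutativeSemigroup N D D) ⟩
      + (D + (N + D))                              ∎)

  -- The integral `y`, with entries of any sign, and the nonnegative rational `N c / p` both
  -- represent `(N , x)`, and they differ by `(s / p) ℓ`. Rounding `s / p` down moves `y` close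
  -- enough to `N c / p`.
  ∈-Δ⇒∈-sumset : ∀ N .{{_ : NonZero N}} {x} → Δ A (x ÷ N) → (x +ᶻ shift) ∈ sumset (D + (N + D)) A
  ∈-Δ⇒∈-sumset N {x} x∈Δ =
    let p-1 , c , sum-c , px≡ = ∈-Δ⇒comb N A x x∈Δ
        y , y≡                = surjective (+ N ∷ x)
        s , e                 = kernel _ (difference∈ker N (suc p-1) sum-c px≡ y≡)
        k , z≡                = roundᵛ p-1 (map (N *_) c) y ℓ s e
    in ∈-sumset-shift N {q = s ℤ./ + suc p-1} {k} y≡ z≡

-- Cardinality and volume

-- Both counts are the same total volume times the `d`-th power of the scale. One common denominator
-- `M` thus controls all its multiples.
length-points-* : ∀ k M .{{_ : NonZero M}} .{{_ : NonZero (k * M)}} (Bs : List (Box d)) iBs iBs′ →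
                  length (Grid.points (k * M) Bs iBs′) ≡ length (Grid.points M Bs iBs) * k ^ d
length-points-* {d} k M Bs iBs iBs′ = ℤ.+-injective (fromℤ-injective (begin
  fromℕ (length (Grid.points (k * M) Bs iBs′))           ≡⟨ Grid.length-points (k * M) Bs iBs′ ⟩
  fromℕ ((k * M) ^ d) ℚ.* totalVolume Bs                 ≡⟨ cong (λ t → fromℕ t ℚ.* totalVolume Bs) (^-distribʳ-* d k M) ⟩
  fromℕ (k ^ d * M ^ d) ℚ.* totalVolume Bs               ≡⟨ cong (ℚ._* totalVolume Bs) (fromℕ-* (k ^ d) (M ^ d)) ⟩
  (fromℕ (k ^ d) ℚ.* fromℕ (M ^ d)) ℚ.* totalVolume Bs   ≡⟨ ℚ.*-assoc (fromℕ (k ^ d)) _ _ ⟩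
  fromℕ (k ^ d) ℚ.* (fromℕ (M ^ d) ℚ.* totalVolume Bs)   ≡⟨ cong (fromℕ (k ^ d) ℚ.*_) (Grid.length-points M Bs iBs) ⟨
  fromℕ (k ^ d) ℚ.* fromℕ (length (Grid.points M Bs iBs)) ≡⟨ fromℕ-* (k ^ d) _ ⟨
  fromℕ (k ^ d * length (Grid.points M Bs iBs))          ≡⟨ cong fromℕ (ℕ.*-comm (k ^ d) _) ⟩
  fromℕ (length (Grid.points M Bs iBs) * k ^ d)          ∎))
  where open ≡-Reasoning

module Cardinality
  {d : ℕ} (A : Vec (ℤ^ d) (2 + d)) (ℓ : ℤ^ (2 + d)) (ℓ≢0 : ℓ ≢ 0ᶻ) (ℓ∈ker : comb⁺ A ℓ ≡ 0ᶻ)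
  (kernel : ∀ x → comb⁺ A x ≡ 0ᶻ → ∃[ t ] x ≡ t ·ᶻ ℓ)
  (surjective : ∀ y → ∃[ c ] comb⁺ A c ≡ y)
  where

  open Relation A ℓ ℓ≢0 ℓ∈ker kernel
  open Dilation A ℓ ℓ≢0 ℓ∈ker kernel surjective

  card-< : ∀ h → h < D → card (sumset h A) ≡ (h + suc d) C suc d
  card-< h h<D = trans (card-sumset-< h<D) (length-compositions (suc d) h)

  card-+ : ∀ h → card (sumset (D + h) A) + ((h + suc d) C suc d) ≡ (D + (h + suc d)) C suc d
  card-+ h = begin
    card (sumset (D + h) A) + ((h + suc d) C suc d)
      ≡⟨ cong (λ t → card (sumset (D + h) A) + t) (length-compositions (suc d) h) ⟨
    card (sumset (D + h) A) + length (compositions (2 + d) h)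
      ≡⟨ card-sumset-+ h ⟩
    length (compositions (2 + d) (D + h))
      ≡⟨ length-compositions (suc d) (D + h) ⟩
    (D + h + suc d) C suc d
      ≡⟨ cong (_C suc d) (ℕ.+-assoc D h (suc d)) ⟩
    (D + (h + suc d)) C suc d ∎
    where open ≡-Reasoning

  private instance
    D-nonZero : NonZero D
    D-nonZero = ℕ.>-nonZero D>0

  open Growth d D (λ h → card (sumset h A)) card-+

  private
    integralBoxes : (Bs : List (Box d)) → ∃[ M-1 ] All.All (IntegralBox (suc M-1)) Bs
    integralBoxes = commonMultiple {P = λ N → IntegralBox N} (λ k B → IntegralBox-* k B) denominatorBox

    rescale : ∀ {M l T} → fromℕ l ≡ fromℕ (M ^ d) ℚ.* T → fromℕ (d ! * l) ≡ fromℕ (M ^ d) ℚ.* (fromℕ (d !) ℚ.* T)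
    rescale {M} {l} {T} eq = begin
      fromℕ (d ! * l)                                    ≡⟨ fromℕ-* (d !) l ⟩
      fromℕ (d !) ℚ.* fromℕ l                            ≡⟨ cong (fromℕ (d !) ℚ.*_) eq ⟩
      fromℕ (d !) ℚ.* (fromℕ (M ^ d) ℚ.* T)              ≡⟨ exchange (fromℕ (d !)) (fromℕ (M ^ d)) T ⟩
      fromℕ (M ^ d) ℚ.* (fromℕ (d !) ℚ.* T)              ∎
      where
      open ≡-Reasoning
      exchange : ∀ a b c → a ℚ.* (b ℚ.* c) ≡ b ℚ.* (a ℚ.* c)
      exchange = solve 3 (λ a b c → a :* (b :* c) := b :* (a :* c)) refl
        where open +-*-Solver

    swap : ∀ M → fromℕ (D * M ^ d) ≡ fromℕ (M ^ d) ℚ.* fromℕ D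
    swap M = trans (fromℕ-* D (M ^ d)) (ℚ.*-comm (fromℕ D) (fromℕ (M ^ d)))

    fromℕ-^-positive : ∀ M .{{_ : NonZero M}} → ℚ.Positive (fromℕ (M ^ d))
    fromℕ-^-positive M = fromℕ-positive (M ^ d) {{ℕ.m^n≢0 M d}}

  asymptotic-≤ : ∀ M .{{_ : NonZero M}} {l T} → fromℕ l ≡ fromℕ (M ^ d) ℚ.* T →
                 (∀ k → l * k ^ d ≤ card (sumset (D + (k * M + D)) A)) → fromℕ (d !) ℚ.* T ℚ.≤ fromℕ D
  asymptotic-≤ M {l} {T} l≡ bound = ℚ.*-cancelˡ-≤-pos (fromℕ (M ^ d)) {{fromℕ-^-positive M}}
    (subst₂ ℚ._≤_ (rescale {M} {l} {T} l≡) (swap M)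
      (fromℤ-mono-≤ {+ (d ! * l)} {+ (D * M ^ d)} (ℤ.+≤+ (leading-≤ M {l} bound))))

  asymptotic-≥ : ∀ M .{{_ : NonZero M}} {l T} → fromℕ l ≡ fromℕ (M ^ d) ℚ.* T →
                 (∀ k .{{_ : NonZero k}} → card (sumset (k * M) A) ≤ l * k ^ d) → fromℕ D ℚ.≤ fromℕ (d !) ℚ.* T
  asymptotic-≥ M {l} {T} l≡ bound = ℚ.*-cancelˡ-≤-pos (fromℕ (M ^ d)) {{fromℕ-^-positive M}}
    (subst₂ ℚ._≤_ (swap M) (rescale {M} {l} {T} l≡)
      (fromℤ-mono-≤ {+ (D * M ^ d)} {+ (d ! * l)} (ℤ.+≤+ (leading-≥ M {l} bound))))

  -- Translation by `shift` embeds the grid points of the inner boxes into the sumset; disjointness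
  -- of the boxes keeps them distinct.
  points≤card : ∀ N .{{_ : NonZero N}} Bs iBs → AllPairs (λ B B′ → ⟦ B ⟧ ⊥ ⟦ B′ ⟧) Bs → ⋃ Bs ⊆ Δ A →
                length (Grid.points N Bs iBs) ≤ card (sumset (D + (N + D)) A)
  points≤card N Bs iBs Bs⊥ Bs⊆Δ = begin
    length points                             ≡⟨ List.length-map (_+ᶻ shift) points ⟨
    length (List.map (_+ᶻ shift) points)      ≤⟨ card-≤ shifted! shifted⊆ ⟩
    card (sumset (D + (N + D)) A)             ∎
    where
    open ℕ.≤-Reasoning
    points = Grid.points N Bs iBs
    shifted! = Unique.map⁺ (+ᶻ-cancelʳ _ _ shift) (Grid.points-unique N Bs iBs Bs⊥)
    shifted⊆ : ∀ {x} → x ∈ List.map (_+ᶻ shift) points → x ∈ sumset (D + (N + D)) A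
    shifted⊆ x∈ with ∈-map⁻ (_+ᶻ shift) x∈
    ... | y , y∈ , refl = ∈-Δ⇒∈-sumset N (Bs⊆Δ (Grid.∈-points⁻ N Bs iBs y∈))

  inner-≤ : d ≥ 1 → (Bs : List (Box d)) → AllPairs (λ B B′ → ⟦ B ⟧ ⊥ ⟦ B′ ⟧) Bs → ⋃ Bs ⊆ Δ A →
            fromℕ (d !) ℚ.* totalVolume Bs ℚ.≤ fromℕ D
  inner-≤ d≥1 Bs Bs⊥ Bs⊆Δ =
    let M-1 , iBs = integralBoxes Bs in asymptotic-≤ (suc M-1) {length (Grid.points (suc M-1) Bs iBs)} {totalVolume Bs} (Grid.length-points (suc M-1) Bs iBs) (bound (suc M-1) iBs)
    where
    0^d≡0 : ∀ {d} → d ≥ 1 → 0 ^ d ≡ 0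
    0^d≡0 (s≤s _) = refl

    bound : ∀ M .{{_ : NonZero M}} iBs k → length (Grid.points M Bs iBs) * k ^ d ≤ card (sumset (D + (k * M + D)) A)
    -- There is no grid of mesh `1 / (k M)` for `k = 0`; here the left side vanishes because
    -- `d ≥ 1`.
    bound M iBs zero = ℕ.≤-trans (ℕ.≤-reflexive (trans (cong (length (Grid.points M Bs iBs) *_) (0^d≡0 d≥1)) (ℕ.*-zeroʳ (length (Grid.points M Bs iBs))))) z≤n
    bound M iBs k@(suc _) = ℕ.≤-trans
      (ℕ.≤-reflexive (sym (length-points-* k M Bs iBs (All.map (λ {B} → IntegralBox-* k B) iBs))))
      (points≤card (k * M) Bs (All.map (λ {B} → IntegralBox-* k B) iBs) Bs⊥ Bs⊆Δ)
      where instance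
        kM-nonZero : NonZero (k * M)
        kM-nonZero = ℕ.m*n≢0 k M

  outer-≥ : (Bs : List (Box d)) → Δ A ⊆ ⋃ Bs → fromℕ D ℚ.≤ fromℕ (d !) ℚ.* totalVolume Bs
  outer-≥ Bs Δ⊆Bs =
    let M-1 , iBs = integralBoxes Bs in asymptotic-≥ (suc M-1) {length (Grid.points (suc M-1) Bs iBs)} {totalVolume Bs} (Grid.length-points (suc M-1) Bs iBs) (bound (suc M-1) iBs)
    where
    bound : ∀ M .{{_ : NonZero M}} iBs k .{{_ : NonZero k}} → card (sumset (k * M) A) ≤ length (Grid.points M Bs iBs) * k ^ d
    bound M iBs k = ℕ.≤-trans
      (card-≥ (λ x∈ → Grid.∈-points⁺ (k * M) Bs iBsₖ (Δ⊆Bs (∈-sumset⇒∈-Δ (k * M) A x∈))))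
      (ℕ.≤-reflexive (length-points-* k M Bs iBs iBsₖ))
      where
      instance
        kM-nonZero : NonZero (k * M)
        kM-nonZero = ℕ.m*n≢0 k M
      iBsₖ = All.map (λ {B} → IntegralBox-* k B) iBs

  -- A gap between `vol` and `v = D / d!` is taken as `ε`. Then either an inner union has total
  -- volume above `v` or a cover has total volume below `v`, against `inner-≤` and `outer-≥`.
  volume : d ≥ 1 → (vol : ℚ) → HasVolume (Δ A) vol → vol ℚ.* fromℕ (d !) ≡ fromℕ D
  volume d≥1 vol hasVolume = trans (cong (ℚ._* fromℕ (d !)) vol≡v) (trans (ℚ.*-comm v _) d!v≡D)
    where
    instance
      d!-nonZero : NonZero (d !)
      d!-nonZero = ℕ._!≢0 d
      d!-positive : ℚ.Positive (fromℕ (d !))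
      d!-positive = fromℕ-positive (d !)

    v : ℚ
    v = + D ℚ./ (d !)

    d!v≡D : fromℕ (d !) ℚ.* v ≡ fromℕ D
    d!v≡D = fromℕ-*-/ (d !) (+ D)

    a-[a-b]≡b : ∀ a b → a ℚ.- (a ℚ.- b) ≡ b
    a-[a-b]≡b = solve 2 (λ a b → a :- (a :- b) := b) refl
      where open +-*-Solver

    a+[b-a]≡b : ∀ a b → a ℚ.+ (b ℚ.- a) ≡ b
    a+[b-a]≡b = solve 2 (λ a b → a :+ (b :- a) := b) refl
      where open +-*-Solver

    0<b-a : ∀ {a b} → a ℚ.< b → 0ℚ ℚ.< b ℚ.- a
    0<b-a {a} {b} a<b = subst (ℚ._< b ℚ.- a) (ℚ.+-inverseʳ a) (ℚ.+-monoˡ-< (ℚ.- a) a<b)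

    vol≤v : vol ℚ.≤ v
    vol≤v = ℚ.≮⇒≥ λ v<vol → let Bs , Bs⊥ , Bs⊆Δ , v<T = proj₁ (hasVolume (vol ℚ.- v) (0<b-a v<vol)) in
      ℚ.<-irrefl refl (ℚ.<-≤-trans (subst (ℚ._< totalVolume Bs) (a-[a-b]≡b vol v) v<T)
        (ℚ.*-cancelˡ-≤-pos (fromℕ (d !)) (ℚ.≤-trans (inner-≤ d≥1 Bs Bs⊥ Bs⊆Δ) (ℚ.≤-reflexive (sym d!v≡D)))))

    v≤vol : v ℚ.≤ vol
    v≤vol = ℚ.≮⇒≥ λ vol<v → let Bs , Δ⊆Bs , T<v = proj₂ (hasVolume (v ℚ.- vol) (0<b-a vol<v)) in
      ℚ.<-irrefl refl (ℚ.<-≤-trans (subst (totalVolume Bs ℚ.<_) (a+[b-a]≡b vol v) T<v)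
        (ℚ.*-cancelˡ-≤-pos (fromℕ (d !)) (ℚ.≤-trans (ℚ.≤-reflexive d!v≡D) (outer-≥ Bs Δ⊆Bs))))

    vol≡v : vol ≡ v
    vol≡v = ℚ.≤-antisym vol≤v v≤vol

  h+d+1 : ∀ h → h + d + 1 ≡ h + suc d
  h+d+1 h = trans (ℕ.+-assoc h d 1) (cong (h ℕ.+_) (ℕ.+-comm d 1))

  below : ∀ h → h < D → card (sumset h A) ≡ (h + d + 1) C (d + 1)
  below h h<D = trans (card-< h h<D) (cong₂ _C_ (sym (h+d+1 h)) (ℕ.+-comm 1 d))

  -- The threshold, an integer that may be negative, is at most `D`, so the count without reducible
  -- compositions applies.
  small : ∀ h → + h ℤ.< + D ℤ.- + d ℤ.- + 1 → card (sumset h A) ≡ (h + d + 1) C (d + 1)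
  small h h< = below h (ℤ.drop‿+<+ (ℤ.<-≤-trans h< (ℤ.≤-trans (ℤ.i-j≤i (+ D ℤ.- + d) (+ 1)) (ℤ.i-j≤i (+ D) (+ d)))))

  above : ∀ h → card (sumset (D + h) A) + ((D + h + d + 1 ∸ D) C (d + 1)) ≡ (D + h + d + 1) C (d + 1)
  above h = begin
    card (sumset (D + h) A) + ((D + h + d + 1 ∸ D) C (d + 1))
      ≡⟨ cong₂ (λ m k → card (sumset (D + h) A) + (m C k)) shift-D (ℕ.+-comm d 1) ⟩
    card (sumset (D + h) A) + ((h + suc d) C suc d)
      ≡⟨ card-+ h ⟩
    (D + (h + suc d)) C suc d
      ≡⟨ cong₂ _C_ (trans (sym (ℕ.+-assoc D h (suc d))) (sym (h+d+1 (D + h)))) (ℕ.+-comm 1 d) ⟩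
    (D + h + d + 1) C (d + 1) ∎
    where
    open ≡-Reasoning
    shift-D : D + h + d + 1 ∸ D ≡ h + suc d
    shift-D = trans (cong (_∸ D) (trans (h+d+1 (D + h)) (ℕ.+-assoc D h (suc d)))) (ℕ.m+n∸m≡n D (h + suc d))

  subtract : ∀ {a b c} → a + b ≡ c → + a ≡ + c ℤ.- + b
  subtract {a} {b} refl = lemma (+ a) (+ b)
    where
    lemma : ∀ a b → a ≡ a ℤ.+ b ℤ.- b
    lemma = solve-∀

  large : ∀ h → + h ℤ.≥ + D ℤ.- + d ℤ.- + 1 →
          + card (sumset h A) ≡ + ((h + d + 1) C (d + 1)) ℤ.- + ((h + d + 1 ∸ D) C (d + 1))
  large h _ with D ℕ.≤? h
  ... | yes D≤h = subst (λ h → + card (sumset h A) ≡ + ((h + d + 1) C (d + 1)) ℤ.- + ((h + d + 1 ∸ D) C (d + 1)))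
                        (ℕ.m+[n∸m]≡n D≤h) (subtract (above (h ∸ D)))
  -- Between the threshold and `D` the upper index is below `d + 1`, so the subtracted coefficient
  -- is 0 and the two formulas agree.
  ... | no  D≰h = subtract (trans (cong (λ t → card (sumset h A) + t) (k>n⇒nCk≡0 h+d+1∸D<d+1))
                                  (trans (ℕ.+-identityʳ _) (below h (ℕ.≰⇒> D≰h))))
    where
    open ℕ.≤-Reasoning
    h+d+1∸D<d+1 : h + d + 1 ∸ D < d + 1
    h+d+1∸D<d+1 = ℕ.m<n+o⇒m∸n<o (h + d + 1) D {{ℕ.>-nonZero (ℕ.m≤n+m 1 d)}} (begin-strict
      h + d + 1    ≡⟨ ℕ.+-assoc h d 1 ⟩
      h + (d + 1)  <⟨ ℕ.+-monoˡ-< (d + 1) (ℕ.≰⇒> D≰h) ⟩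
      D + (d + 1)  ∎)

theorem1p2 : ∀ (d : ℕ) → d ≥ 1 →
    (A : Vec (ℤ^ d) (2 + d)) → Unique A →
    Generates (differenceSet A) →
    (vol : ℚ) → HasVolume (Δ A) vol →
    ∃[ D ] vol ℚ.* fromℤ (+ (d !)) ≡ fromℤ (+ D)
    × (∀ (h : ℕ) → + h ℤ.< + D ℤ.- + d ℤ.- + 1 →
    card (sumset h A) ≡ (h + d + 1) C (d + 1))
    × (∀ (h : ℕ) → + h ℤ.≥ + D ℤ.- + d ℤ.- + 1 →
    + card (sumset h A) ≡
    + ((h + d + 1) C (d + 1)) ℤ.- + ((h + d + 1 ∸ D) C (d + 1)))
theorem1p2 d d≥1 A _ G vol hasVolume =
  let ℓ , ℓ≢0 , ℓ∈ker , kernel = cyclicKernel (comb⁺ A) (comb⁺-linear A) (comb⁺-surjective A G)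
      open Cardinality A ℓ ℓ≢0 ℓ∈ker kernel (comb⁺-surjective A G)
  in Relation.D A ℓ ℓ≢0 ℓ∈ker kernel , volume d≥1 vol hasVolume , small , large
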